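{- In the worst violated constraint model, there is an algorithm which, given oracle access to a hidden satisfiable repetition-free 2SAT instance $\Phi$ on $n$ variables, generates a satisfying assignment of $\Phi$ in time $O(n^2)$.
   Context: A SAT formula on Boolean variables $x_1,\dots,x_n$ is a conjunction of clauses $C_1,\dots,C_m$, each a disjunction of literals ($x_i$ or $\overline{x}_i$) on pairwise distinct variables; it is a 2SAT instance if each clause has at most $2$ literals. It is repetition-free if no two of its clauses are the same (i.e. no two clauses have the same set of literals). Worst violated constraint model: the formula is hidden and is accessed only through an oracle. A query is a probabilistic assignment $\mathbf{a}:[n]\to[0,1]$, meaning that independently $\Pr[x_i=1]=\mathbf{a}(i)$ and $\Pr[\overline{x}_i=1]=1-\mathbf{a}(i)$. The violation probability of a clause $C_j$ with literal set $T(C_j)$ is $\Pr[C_j=0]=\prod_{\ell\in T(C_j)}\Pr[\ell=0]$. If all clauses have violation probability $0$, the oracle reports that the formula is satisfied; otherwise it returns the index $j$ of a clause with the highest violation probability, breaking ties arbitrarily (possibly adversarially). Running time is total running time, with each oracle query costing unit time. -}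

module Defs where

open import Data.Bool using (Bool; true; false; if_then_else_; not)
open import Data.Fin using (Fin; toℕ)
import Data.Integer as ℤ
import Data.Integer.Properties as ℤ
open import Data.List using (List; []; _∷_; map; foldr; length)
open import Data.List.Relation.Binary.BagAndSetEquality using (_∼[_]_; set)
open import Data.List.Relation.Unary.Any using (Any)
open import Data.List.Relation.Unary.Unique.Propositional using (Unique)
open import Data.Maybe using (Maybe; just; nothing)
open import Data.Nat using (ℕ; suc; _≤_; _+_; _∸_; _*_; _⊓_; _≡ᵇ_; s≤s; z≤n)
import Data.Nat.Properties as ℕ
open import Data.Product using (_×_; _,_; ∃; ∃₂)
open import Data.Rational as ℚ using (ℚ; 0ℚ; 1ℚ)
import Data.Rational.Properties as ℚ
import Data.Rational.Unnormalised as ℚᵘ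
import Data.Rational.Unnormalised.Properties as ℚᵘ
open import Relation.Binary.PropositionalEquality
  using (_≡_; _≢_; refl; sym; cong; subst₂)
open import Relation.Nullary using (¬_; contradiction)

------------------------------------------------------------------------
-- SAT formulas

record Literal (n : ℕ) : Set where
  constructor literal
  field
    var      : Fin n
    positive : Bool

open Literal public

record Clause (n : ℕ) : Set where
  constructor clause
  field
    literals     : List (Literal n)
    distinctVars : Unique (map var literals)

open Clause public

Formula : (n m : ℕ) → Set
Formula n m = Fin m → Clause n

Is2SAT : ∀ {n m} → Formula n m → Set
Is2SAT Φ = ∀ j → length (literals (Φ j)) ≤ 2

RepetitionFree : ∀ {n m} → Formula n m → Set
RepetitionFree Φ =
  ∀ j k → literals (Φ j) ∼[ set ] literals (Φ k) → j ≡ k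

Satisfies : ∀ {n m} → (Fin n → Bool) → Formula n m → Set
Satisfies σ Φ = ∀ j → Any (λ ℓ → σ (var ℓ) ≡ positive ℓ) (literals (Φ j))

Satisfiable : ∀ {n m} → Formula n m → Set
Satisfiable Φ = ∃ λ σ → Satisfies σ Φ

------------------------------------------------------------------------
-- Probabilistic assignments and the worst-violated-constraint oracle

record Probability : Set where
  constructor probability
  field
    value : ℚ
    lower : 0ℚ ℚ.≤ value
    upper : value ℚ.≤ 1ℚ

open Probability public

Query : ℕ → Set
Query n = Fin n → Probability

probFalse : ∀ {n} → Query n → Literal n → ℚ
probFalse a ℓ =
  if positive ℓ then 1ℚ ℚ.- value (a (var ℓ)) else value (a (var ℓ))

violation : ∀ {n} → Query n → Clause n → ℚ
violation a C = foldr (λ ℓ p → probFalse a ℓ ℚ.* p) 1ℚ (literals C)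

-- Admissible oracle answers; `nothing` reports that the formula is satisfied.
WorstViolated : ∀ {n m} → Formula n m → Query n → Maybe (Fin m) → Set
WorstViolated Φ a nothing  = ∀ k → violation a (Φ k) ≡ 0ℚ
WorstViolated Φ a (just j) =
  ¬ (∀ k → violation a (Φ k) ≡ 0ℚ) ×
  (∀ k → violation a (Φ k) ℚ.≤ violation a (Φ j))

-- The answer may depend on all earlier queries, so ties may be broken
-- differently each time, by an adaptive adversary.
record Oracle {n m : ℕ} (Φ : Formula n m) : Set where
  field
    answer : List (Query n) → Query n → Maybe (Fin m)
    sound  : ∀ past a → WorstViolated Φ a (answer past a)

open Oracle public

------------------------------------------------------------------------
-- Algorithms: programs for a unit-cost random access machine over ℕ, with
-- addition and truncated subtraction, scalar registers and one-dimensional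
-- arrays.  A program mentions finitely many registers and arrays, and it does
-- not depend on the number of variables.

Reg Arr : Set
Reg = ℕ
Arr = ℕ

infixl 6 _⊕_ _⊖_
data Expr : Set where
  const   : ℕ → Expr
  reg     : Reg → Expr
  _[_]    : Arr → Expr → Expr
  _⊕_ _⊖_ : Expr → Expr → Expr

infixr 4 _⨟_
infix  5 _≔_ _[_]≔_
data Cmd : Set where
  skip            : Cmd
  _≔_             : Reg → Expr → Cmd
  _[_]≔_          : Arr → Expr → Expr → Cmd
  _⨟_             : Cmd → Cmd → Cmd
  if≢0_then_else_ : Expr → Cmd → Cmd → Cmd
  while≢0_loop_     : Expr → Cmd → Cmd
  query           : Reg → Cmd

record State (n : ℕ) : Set where
  constructor state
  field
    regs : Reg → ℕ
    arrs : Arr → ℕ → ℕ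
    past : List (Query n)    -- latest query first; invisible to programs

open State public

update : ∀ {A : Set} → ℕ → A → (ℕ → A) → ℕ → A
update i v f j = if i ≡ᵇ j then v else f j

setReg : ∀ {n} → Reg → ℕ → State n → State n
setReg r v s = record s { regs = update r v (regs s) }

setArr : ∀ {n} → Arr → ℕ → ℕ → State n → State n
setArr x i v s = record s { arrs = update x (update i v (arrs s x)) (arrs s) }

eval : ∀ {n} → State n → Expr → ℕ
eval s (const k) = k
eval s (reg r)   = regs s r
eval s (x [ e ]) = arrs s x (eval s e)
eval s (e ⊕ f)   = eval s e + eval s f
eval s (e ⊖ f)   = eval s e ∸ eval s f

exprTime : Expr → ℕ
exprTime (const k) = 1
exprTime (reg r)   = 1
exprTime (x [ e ]) = 1 + exprTime e
exprTime (e ⊕ f)   = 1 + exprTime e + exprTime f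
exprTime (e ⊖ f)   = 1 + exprTime e + exprTime f

-- The fraction k / (d + 1), with k cut off at d + 1 so that any two numbers
-- encode a probability; every rational in [0,1] is obtained.
fraction : ℕ → ℕ → Probability
fraction k d = probability (ℚ.fromℚᵘ q) 0≤q q≤1
  where
  q : ℚᵘ.ℚᵘ
  q = ℚᵘ.mkℚᵘ (ℤ.+ (k ⊓ suc d)) d

  q≃ : q ℚᵘ.≃ ℚ.toℚᵘ (ℚ.fromℚᵘ q)
  q≃ = ℚᵘ.≃-sym (ℚ.toℚᵘ-fromℚᵘ q)

  0≤q : 0ℚ ℚ.≤ ℚ.fromℚᵘ q
  0≤q = ℚ.toℚᵘ-cancel-≤
    (ℚᵘ.≤-trans (ℚᵘ.nonNegative⁻¹ q) (ℚᵘ.≤-reflexive q≃))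

  q≤1 : ℚ.fromℚᵘ q ℚ.≤ 1ℚ
  q≤1 = ℚ.toℚᵘ-cancel-≤ (ℚᵘ.≤-trans (ℚᵘ.≤-reflexive (ℚᵘ.≃-sym q≃))
    (ℚᵘ.*≤* (subst₂ ℤ._≤_ (sym (ℤ.*-identityʳ _)) (sym (ℤ.*-identityˡ _))
      (ℤ.+≤+ (ℕ.m⊓n≤n k (suc d))))))

inputReg : Reg
inputReg = 0

numerators denominators-1 outputs : Arr
numerators     = 0
denominators-1 = 1
outputs        = 2

initial : (n : ℕ) → State n
initial n = state (update inputReg n (λ _ → 0)) (λ _ _ → 0) []

-- The query is kept in memory and can be modified entry by entry, so asking it
-- is a single step.
currentQuery : ∀ {n} → State n → Query n
currentQuery s i =
  fraction (arrs s numerators (toℕ i)) (arrs s denominators-1 (toℕ i))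

output : ∀ {n} → State n → Fin n → Bool
output s i = not (arrs s outputs (toℕ i) ≡ᵇ 0)

encodeAnswer : ∀ {m} → Maybe (Fin m) → ℕ
encodeAnswer nothing  = 0
encodeAnswer (just j) = suc (toℕ j)

ask : ∀ {n m} {Φ : Formula n m} → Oracle Φ → Reg → State n → State n
ask O r s = record (setReg r (encodeAnswer (answer O (past s) a)) s)
  { past = a ∷ past s }
  where a = currentQuery s

-- O ⊢ c , s ⇓ s′ [ t ]: started in s, program c halts in s′ after t steps.
infix 3 _⊢_,_⇓_[_]
data _⊢_,_⇓_[_] {n m : ℕ} {Φ : Formula n m} (O : Oracle Φ) :
       Cmd → State n → State n → ℕ → Set where

  ⇓skip   : ∀ {s} → O ⊢ skip , s ⇓ s [ 1 ]

  ⇓assign : ∀ {r e s} →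
            O ⊢ r ≔ e , s ⇓ setReg r (eval s e) s [ 1 + exprTime e ]

  ⇓store  : ∀ {x e f s} →
            O ⊢ x [ e ]≔ f , s ⇓ setArr x (eval s e) (eval s f) s
              [ 1 + exprTime e + exprTime f ]

  ⇓seq    : ∀ {c d s s′ s″ t u} →
            O ⊢ c , s ⇓ s′ [ t ] → O ⊢ d , s′ ⇓ s″ [ u ] →
            O ⊢ c ⨟ d , s ⇓ s″ [ t + u ]

  ⇓then   : ∀ {e c d s s′ t} → eval s e ≢ 0 → O ⊢ c , s ⇓ s′ [ t ] →
            O ⊢ if≢0 e then c else d , s ⇓ s′ [ 1 + exprTime e + t ]

  ⇓else   : ∀ {e c d s s′ t} → eval s e ≡ 0 → O ⊢ d , s ⇓ s′ [ t ] →
            O ⊢ if≢0 e then c else d , s ⇓ s′ [ 1 + exprTime e + t ]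

  ⇓loop   : ∀ {e c s s′ s″ t u} → eval s e ≢ 0 →
            O ⊢ c , s ⇓ s′ [ t ] → O ⊢ while≢0 e loop c , s′ ⇓ s″ [ u ] →
            O ⊢ while≢0 e loop c , s ⇓ s″ [ 1 + exprTime e + t + u ]

  ⇓exit   : ∀ {e c s} → eval s e ≡ 0 →
            O ⊢ while≢0 e loop c , s ⇓ s [ 1 + exprTime e ]

  ⇓query  : ∀ {r s} → O ⊢ query r , s ⇓ ask O r s [ 1 ]

-- Against a given oracle a program has at most one run, so exhibiting a run
-- that halts describes the behaviour of the program completely.
deterministic : ∀ {n m} {Φ : Formula n m} {O : Oracle Φ} {c s s₁ s₂ t₁ t₂} →
                O ⊢ c , s ⇓ s₁ [ t₁ ] → O ⊢ c , s ⇓ s₂ [ t₂ ] →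
                s₁ ≡ s₂ × t₁ ≡ t₂
deterministic ⇓skip   ⇓skip   = refl , refl
deterministic ⇓assign ⇓assign = refl , refl
deterministic ⇓store  ⇓store  = refl , refl
deterministic ⇓query  ⇓query  = refl , refl
deterministic (⇓seq p q) (⇓seq p′ q′) with deterministic p p′
... | refl , refl with deterministic q q′
... | refl , refl = refl , refl
deterministic (⇓then _ p) (⇓then _ p′) with deterministic p p′
... | refl , refl = refl , refl
deterministic (⇓then ≢0 _) (⇓else ≡0 _) = contradiction ≡0 ≢0
deterministic (⇓else ≡0 _) (⇓then ≢0 _) = contradiction ≡0 ≢0
deterministic (⇓else _ p) (⇓else _ p′) with deterministic p p′
... | refl , refl = refl , refl
deterministic (⇓loop _ p q) (⇓loop _ p′ q′) with deterministic p p′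
... | refl , refl with deterministic q q′
... | refl , refl = refl , refl
deterministic (⇓loop ≢0 _ _) (⇓exit ≡0) = contradiction ≡0 ≢0
deterministic (⇓exit ≡0) (⇓loop ≢0 _ _) = contradiction ≡0 ≢0
deterministic (⇓exit _) (⇓exit _) = refl , refl

------------------------------------------------------------------------
-- Asymptotics

infix 4 _∈O_
_∈O_ : (ℕ → ℕ) → (ℕ → ℕ) → Set
f ∈O g = ∃₂ λ K n₀ → ∀ n → n₀ ≤ n → f n ≤ K * g n

{-# OPTIONS --safe #-}
-- Falsify two literals and give all other variables probability 1/4 of being
-- true, then 3/4.  If the clause on these two literals is present, and neither is
-- a unit clause, then it alone is violated with certainty and is returned both times.
-- Conversely, setting the other variables to 0, or to 1, either satisfies the formula
-- or violates some clause; the latter has violation probability at least 9/16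
-- under the corresponding 1/4 or 3/4, so that a clause returned both times
-- has no further literal (this would be false with probability 1/4 once).  Hence O(n²)
-- queries reveal all unit clauses, and then all clauses free of unit literals,
-- as a table indexed by the oracle's replies.
--
-- Afterwards variables are fixed one at a time, with 1/2 for unassigned ones.  A
-- clause with one false and one unassigned literal beats the clauses with two unassigned
-- literals, so each query yields, by a table lookup, a unit propagation, a
-- contradiction, or the guarantee that the partial assignment is closed.  A closed
-- assignment is kept, since the remaining clauses can be satisfied independently; a
-- contradiction forces the opposite value.  This takes n attempts of O(n) steps.
module Submission where

open import Defs
open import Data.Bool using (Bool; true; false; not; if_then_else_)
open import Data.Bool.Properties using (not-injective; not-involutive; not-¬)
open import Data.Fin using (Fin; toℕ; fromℕ<)
open import Data.Fin.Properties using (toℕ<n; toℕ-injective; toℕ-fromℕ<)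
import Data.Integer as ℤ
import Data.Integer.Properties as ℤ
open import Data.List using (List; []; _∷_; length; foldr)
open import Data.List.Membership.Propositional using (_∈_)
open import Data.List.Relation.Unary.All as All using (All; []; _∷_)
open import Data.List.Relation.Unary.AllPairs using (_∷_)
open import Data.List.Relation.Unary.Any as Any using (Any; here; there)
open import Data.Maybe using (just; nothing)
open import Data.Nat
open import Data.Nat.Properties
open import Data.Product using (_×_; _,_; ∃; ∃₂; proj₁; proj₂)
open import Data.Rational as ℚ using (ℚ; 0ℚ; 1ℚ)
import Data.Rational.Properties as ℚ
import Data.Rational.Unnormalised as ℚᵘ
import Data.Rational.Unnormalised.Properties as ℚᵘ
open import Data.Sum as Sum using (_⊎_; inj₁; inj₂)
open import Function using (_∘_; id; case_of_; mk⇔)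
open import Relation.Binary.PropositionalEquality hiding ([_])
open import Relation.Nullary using (¬_; yes; no; contradiction)

-- Bounded programs and their weakest preconditions

-- Loops only count from 0 up to `n`, so that a time bound can be read off the syntax.
data Prog : Set where
  skip            : Prog
  _≔_             : Reg → Expr → Prog
  _[_]≔_          : Arr → Expr → Expr → Prog
  _⨟_             : Prog → Prog → Prog
  if≢0_then_else_ : Expr → Prog → Prog → Prog
  for             : Reg → Prog → Prog
  query           : Reg → Prog

toCmd : Prog → Cmd
toCmd skip                     = skip
toCmd (r ≔ e)                  = r ≔ e
toCmd (x [ e ]≔ f)             = x [ e ]≔ f
toCmd (p ⨟ q)                  = toCmd p ⨟ toCmd q
toCmd (if≢0 e then p else q)   = if≢0 e then toCmd p else toCmd q
toCmd (for r p)                =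
  r ≔ const 0 ⨟ while≢0 reg inputReg ⊖ reg r loop (toCmd p ⨟ r ≔ const 1 ⊕ reg r)
toCmd (query r)                = query r

-- Both branches of a conditional are charged, which avoids a maximum. In a loop, 2 pays for
-- resetting the counter, the first 4 for a guard test, the second for the increment and the last
-- for the failing test.
cost : ℕ → Prog → ℕ
cost n skip                   = 1
cost n (r ≔ e)                = 1 + exprTime e
cost n (x [ e ]≔ f)           = 1 + exprTime e + exprTime f
cost n (p ⨟ q)                = cost n p + cost n q
cost n (if≢0 e then p else q) = 1 + exprTime e + (cost n p + cost n q)
cost n (for r p)              = 2 + (n * (4 + (cost n p + 4)) + 4)
cost n (query r)              = 1

-- Loop nesting as the degree of the running time

nesting : Prog → ℕ
nesting (p ⨟ q)                = nesting p ⊔ nesting q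
nesting (if≢0 e then p else q) = nesting p ⊔ nesting q
nesting (for r p)              = suc (nesting p)
nesting _                      = 0

-- Meant for `n ≥ 1`, where constants are absorbed by `n ^ nesting p`. A loop adds 6 = 2 + 4 once
-- and 8 = 4 + 4 for each round.
coefficient : Prog → ℕ
coefficient (p ⨟ q)                = coefficient p + coefficient q
coefficient (if≢0 e then p else q) =
  1 + exprTime e + (coefficient p + coefficient q)
coefficient (for r p)              = 6 + (8 + coefficient p)
coefficient p                      = cost 0 p

module _ (n : ℕ) .{{_ : NonZero n}} where
  open ≤-Reasoning

  const≤*^ : ∀ c d → c ≤ c * n ^ d
  const≤*^ c d = m≤m*n c (n ^ d) {{m^n≢0 n d}}

  widen : ∀ {t} c d d′ → d ≤ d′ → t ≤ c * n ^ d → t ≤ c * n ^ d′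
  widen c _ _ d≤d′ t≤ = ≤-trans t≤ (*-monoʳ-≤ c (^-monoʳ-≤ n d≤d′))

  plus-bound : ∀ {t u} a b d → t ≤ a * n ^ d → u ≤ b * n ^ d →
               t + u ≤ (a + b) * n ^ d
  plus-bound a b d t≤ u≤ =
    ≤-trans (+-mono-≤ t≤ u≤) (≤-reflexive (sym (*-distribʳ-+ (n ^ d) a b)))

  join-bound : ∀ p q → cost n p ≤ coefficient p * n ^ nesting p →
    cost n q ≤ coefficient q * n ^ nesting q →
    cost n p + cost n q ≤
    (coefficient p + coefficient q) * n ^ (nesting p ⊔ nesting q)
  join-bound p q p≤ q≤ =
    plus-bound (coefficient p) (coefficient q) (nesting p ⊔ nesting q)
      (widen (coefficient p) (nesting p) _ (m≤m⊔n _ _) p≤)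
      (widen (coefficient q) (nesting q) _ (m≤n⊔m (nesting p) _) q≤)

  cost-bound : ∀ p → cost n p ≤ coefficient p * n ^ nesting p
  cost-bound skip         = const≤*^ 1 0
  cost-bound (r ≔ e)      = const≤*^ (1 + exprTime e) 0
  cost-bound (x [ e ]≔ f) = const≤*^ (1 + exprTime e + exprTime f) 0
  cost-bound (query r)    = const≤*^ 1 0
  cost-bound (p ⨟ q)      = join-bound p q (cost-bound p) (cost-bound q)
  cost-bound (if≢0 e then p else q) =
    plus-bound (1 + exprTime e) (coefficient p + coefficient q)
      (nesting p ⊔ nesting q) (const≤*^ (1 + exprTime e) (nesting p ⊔ nesting q))
      (join-bound p q (cost-bound p) (cost-bound q))
  cost-bound (for r p) = begin
    2 + (n * (4 + (cost n p + 4)) + 4)        ≡⟨ +-assoc 2 _ 4 ⟨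
    2 + n * (4 + (cost n p + 4)) + 4          ≡⟨ +-comm _ 4 ⟩
    6 + n * (4 + (cost n p + 4))
      ≡⟨ cong (λ z → 6 + n * (4 + z)) (+-comm (cost n p) 4) ⟩
    6 + n * (8 + cost n p)
      ≤⟨ plus-bound 6 (8 + coefficient p) (suc (nesting p))
           (const≤*^ 6 (suc (nesting p)))
           (begin
             n * (8 + cost n p)
               ≤⟨ *-monoʳ-≤ n (plus-bound 8 (coefficient p) (nesting p)
                    (const≤*^ 8 (nesting p)) (cost-bound p)) ⟩
             n * ((8 + coefficient p) * n ^ nesting p)
               ≡⟨ *-assoc n (8 + coefficient p) _ ⟨
             n * (8 + coefficient p) * n ^ nesting p
               ≡⟨ cong (_* n ^ nesting p) (*-comm n (8 + coefficient p)) ⟩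
             (8 + coefficient p) * n * n ^ nesting p
               ≡⟨ *-assoc (8 + coefficient p) n _ ⟩
             (8 + coefficient p) * n ^ suc (nesting p) ∎) ⟩
    coefficient (for r p) * n ^ suc (nesting p) ∎

cost-O : ∀ p → (λ n → cost n p) ∈O (λ n → n ^ nesting p)
-- The threshold is 1 because `0 ^ nesting p` vanishes as soon as there is a loop.
cost-O p = coefficient p , 1 , λ { n@(suc _) _ → cost-bound n p }

-- Total correctness, with loops treated by invariants

module Hoare {n m} {Φ : Formula n m} (O : Oracle Φ) where

  Halts : Prog → (State n → Set) → State n → Set
  Halts p Q s = ∃₂ λ s′ t → (O ⊢ toCmd p , s ⇓ s′ [ t ]) × t ≤ cost n p × Q s′

  -- A loop has no structural precondition; its clause is the bare halting claim, which `for-rule`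
  -- derives from an invariant.
  wp : Prog → (State n → Set) → State n → Set
  wp skip                   Q s = Q s
  wp (r ≔ e)                Q s = Q (setReg r (eval s e) s)
  wp (x [ e ]≔ f)           Q s = Q (setArr x (eval s e) (eval s f) s)
  wp (p ⨟ q)                Q s = wp p (wp q Q) s
  wp (if≢0 e then p else q) Q s =
    (eval s e ≢ 0 → wp p Q s) × (eval s e ≡ 0 → wp q Q s)
  wp (for r p)              Q s = Halts (for r p) Q s
  wp (query r)              Q s = Q (ask O r s)

  wp-sound : ∀ p {Q s} → wp p Q s → Halts p Q s
  wp-sound skip         q = _ , _ , ⇓skip , ≤-refl , q
  wp-sound (r ≔ e)      q = _ , _ , ⇓assign , ≤-refl , q
  wp-sound (x [ e ]≔ f) q = _ , _ , ⇓store , ≤-refl , q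
  wp-sound (query r)    q = _ , _ , ⇓query , ≤-refl , q
  wp-sound (for r p)    h = h
  wp-sound (p ⨟ q) w =
    let _ , _ , run , t≤ , w′ = wp-sound p w
        _ , _ , run′ , u≤ , q′ = wp-sound q w′
    in  _ , _ , ⇓seq run run′ , +-mono-≤ t≤ u≤ , q′
  wp-sound (if≢0 e then p else q) {s = s} (wₚ , w_q) with eval s e ≟ 0
  ... | no ≢0  =
    let _ , _ , run , t≤ , q′ = wp-sound p (wₚ ≢0)
    in  _ , _ , ⇓then ≢0 run ,
        +-monoʳ-≤ (1 + exprTime e) (≤-trans t≤ (m≤m+n _ _)) , q′
  ... | yes ≡0 =
    let _ , _ , run , t≤ , q′ = wp-sound q (w_q ≡0)
    in  _ , _ , ⇓else ≡0 run ,
        +-monoʳ-≤ (1 + exprTime e) (≤-trans t≤ (m≤n+m _ (cost n p))) , q′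

  -- The invariant is required after the increment that `toCmd` appends to the body; the body itself
  -- has to preserve the counter and the input register.
  Next : Reg → (ℕ → State n → Set) → ℕ → State n → Set
  Next r I k s = regs s r ≡ k × regs s inputReg ≡ n × I (suc k) (setReg r (suc k) s)

  module _ (r : Reg) (r≢0 : (r ≡ᵇ inputReg) ≡ false) (p : Prog)
           (I : ℕ → State n → Set)
           (step : ∀ k s → k < n → regs s r ≡ k → regs s inputReg ≡ n → I k s →
                   wp p (Next r I k) s) where

    private
      At : ℕ → State n → Set
      At k s = regs s r ≡ k × regs s inputReg ≡ n × I k s

      ≡ᵇ-refl : ∀ k → (k ≡ᵇ k) ≡ true
      ≡ᵇ-refl zero    = refl
      ≡ᵇ-refl (suc k) = ≡ᵇ-refl k

      reset : ∀ {k} s → regs s inputReg ≡ n → I k (setReg r k s) →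
              At k (setReg r k s)
      reset s ≡n i rewrite ≡ᵇ-refl r | r≢0 = refl , ≡n , i

      -- Induction on the number `d` of rounds still to come, which also bounds the remaining time.
      iterate : ∀ d k s → k + d ≡ n → At k s → ∃₂ λ s′ t →
             (O ⊢ while≢0 reg inputReg ⊖ reg r loop
                    (toCmd p ⨟ r ≔ const 1 ⊕ reg r) , s ⇓ s′ [ t ]) ×
             t ≤ d * (4 + (cost n p + 4)) + 4 × At n s′
      iterate zero k s k+0≡n (r≡k , in≡n , i) =
        s , 4 , ⇓exit (trans (cong₂ _∸_ in≡n (trans r≡k k≡n)) (n∸n≡0 n)) , ≤-refl ,
        trans r≡k k≡n , in≡n , subst (λ k → I k s) k≡n i
        where k≡n = trans (sym (+-identityʳ k)) k+0≡n
      iterate (suc d) k s k+d≡n (r≡k , in≡n , i) =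
        let k<n = subst (k <_) k+d≡n (m<m+n k z<s)
            ≢0  = m<n⇒n≢0 (subst₂ (λ a b → 0 < a ∸ b) (sym in≡n) (sym r≡k)
                            (m<n⇒0<n∸m k<n))
            s₁ , t₁ , run₁ , t₁≤ , r≡k₁ , in≡n₁ , i₁ =
              wp-sound p (step k s k<n r≡k in≡n i)
            at = subst (λ v → At (suc k) (setReg r (suc v) s₁)) (sym r≡k₁)
                   (reset s₁ in≡n₁ i₁)
            s₂ , t₂ , run₂ , t₂≤ , at₂ =
              iterate d (suc k) _ (trans (sym (+-suc k d)) k+d≡n) at
        in  s₂ , _ , ⇓loop ≢0 (⇓seq run₁ ⇓assign) run₂ ,
            ≤-trans (+-mono-≤ (+-monoʳ-≤ 4 (+-monoˡ-≤ 4 t₁≤)) t₂≤)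
              (≤-reflexive (sym (+-assoc (4 + (cost n p + 4)) _ 4))) ,
            at₂

    for-rule : ∀ {Q s} → regs s inputReg ≡ n → I 0 (setReg r 0 s) →
               (∀ s′ → regs s′ inputReg ≡ n → I n s′ → Q s′) → wp (for r p) Q s
    for-rule {s = s} in≡n i exit =
      let s′ , t , run , t≤ , _ , in≡n′ , i′ = iterate n 0 _ refl (reset s in≡n i)
      in  s′ , _ , ⇓seq ⇓assign run , s≤s (s≤s t≤) , exit s′ in≡n′ i′

-- Violation weights

update-cases : ∀ {A : Set} (f : ℕ → A) i {v} x →
               (i ≡ x × update i v f x ≡ v) ⊎ (i ≢ x × update i v f x ≡ f x)
update-cases f zero    zero    = inj₁ (refl , refl)
update-cases f zero    (suc x) = inj₂ ((λ ()) , refl)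
update-cases f (suc i) zero    = inj₂ ((λ ()) , refl)
update-cases f (suc i) (suc x) with update-cases (f ∘ suc) i x
... | inj₁ (refl , eq) = inj₁ (refl , eq)
... | inj₂ (i≢x , eq)  = inj₂ (i≢x ∘ suc-injective , eq)

update-same : ∀ {A : Set} (f : ℕ → A) i {v} → update i v f i ≡ v
update-same f zero    = refl
update-same f (suc i) = update-same (f ∘ suc) i

update-other : ∀ {A : Set} (f : ℕ → A) {i x v} → i ≢ x → update i v f x ≡ f x
update-other f {i} {x} i≢x with update-cases f i x
... | inj₁ (i≡x , _) = contradiction i≡x i≢x
... | inj₂ (_ , eq)  = eq

-- A numerator y stands for the probability y / 4.

level : Bool → ℕ
level false = 0
level true  = 4

falsity : Bool → ℕ → ℕ
falsity true  y = 4 ∸ y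
falsity false y = y ⊓ 4

litFalsity : ∀ {n} → (ℕ → ℕ) → Literal n → ℕ
litFalsity f ℓ = falsity (positive ℓ) (f (toℕ (var ℓ)))

-- Sixteen times the violation probability, for clauses with at most two literals.
listWeight : ∀ {n} → (ℕ → ℕ) → List (Literal n) → ℕ
listWeight f []           = 16
listWeight f (ℓ ∷ [])     = litFalsity f ℓ * 4
listWeight f (ℓ ∷ ℓ′ ∷ _) = litFalsity f ℓ * litFalsity f ℓ′

weight : ∀ {n} → (ℕ → ℕ) → Clause n → ℕ
weight f C = listWeight f (literals C)

opaque
  quarters sixteenths : ℕ → ℚ
  quarters k   = ℚ.fromℚᵘ (ℚᵘ.mkℚᵘ (ℤ.+ k) 3)
  sixteenths k = ℚ.fromℚᵘ (ℚᵘ.mkℚᵘ (ℤ.+ k) 15)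

  sixteenths-0 : sixteenths 0 ≡ 0ℚ
  sixteenths-0 = refl

  sixteenths-16 : sixteenths 16 ≡ 1ℚ
  sixteenths-16 = refl

  toℚᵘ-sixteenths : ∀ k → ℚ.toℚᵘ (sixteenths k) ℚᵘ.≃ ℚᵘ.mkℚᵘ (ℤ.+ k) 15
  toℚᵘ-sixteenths k = ℚ.toℚᵘ-fromℚᵘ _

  sixteenths-reflects-≤ : ∀ {k l} → sixteenths k ℚ.≤ sixteenths l → k ≤ l
  sixteenths-reflects-≤ {k} {l} k≤l = ℤ.drop‿+≤+ (ℤ.*-cancelʳ-≤-pos _ _ (ℤ.+ 16) (
    ℚᵘ.drop-*≤* (ℚᵘ.≤-trans (ℚᵘ.≤-reflexive (ℚᵘ.≃-sym (toℚᵘ-sixteenths k)))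
      (ℚᵘ.≤-trans (ℚ.toℚᵘ-mono-≤ k≤l) (ℚᵘ.≤-reflexive (toℚᵘ-sixteenths l))))))

  sixteenths≡0 : ∀ {k} → sixteenths k ≡ 0ℚ → k ≡ 0
  sixteenths≡0 eq = n≤0⇒n≡0 (sixteenths-reflects-≤ (ℚ.≤-reflexive eq))

  quarters-4 : quarters 4 ≡ 1ℚ
  quarters-4 = refl

  quarters-* : ∀ k l → quarters k ℚ.* quarters l ≡ sixteenths (k * l)
  quarters-* k l = ℚ.toℚᵘ-injective (begin
    ℚ.toℚᵘ (quarters k ℚ.* quarters l)
      ≈⟨ ℚ.toℚᵘ-homo-* (quarters k) (quarters l) ⟩
    ℚ.toℚᵘ (quarters k) ℚᵘ.* ℚ.toℚᵘ (quarters l)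
      ≈⟨ ℚᵘ.*-cong (ℚ.toℚᵘ-fromℚᵘ (ℚᵘ.mkℚᵘ (ℤ.+ k) 3))
                  (ℚ.toℚᵘ-fromℚᵘ (ℚᵘ.mkℚᵘ (ℤ.+ l) 3)) ⟩
    ℚᵘ.mkℚᵘ (ℤ.+ k ℤ.* ℤ.+ l) 15
      ≡⟨ cong (λ z → ℚᵘ.mkℚᵘ z 15) (ℤ.pos-* k l) ⟨
    ℚᵘ.mkℚᵘ (ℤ.+ (k * l)) 15
      ≈⟨ toℚᵘ-sixteenths (k * l) ⟨
    ℚ.toℚᵘ (sixteenths (k * l)) ∎)
    where open ℚᵘ.≃-Reasoning

  -- `fraction` cuts numerators off at 4, as `falsity` does. For the complement, the values up to 4
  -- are checked one by one and all larger ones behave like 4.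
  fraction-quarters : ∀ u y →
    (if u then 1ℚ ℚ.- value (fraction y 3) else value (fraction y 3)) ≡
    quarters (falsity u y)
  fraction-quarters true  0 = refl
  fraction-quarters true  1 = refl
  fraction-quarters true  2 = refl
  fraction-quarters true  3 = refl
  fraction-quarters true  4 = refl
  fraction-quarters true  (suc (suc (suc (suc (suc _))))) = refl
  fraction-quarters false y = refl

-- The stored 3 is the denominator 4 less one. A product of two quarters is counted in sixteenths,
-- and a single literal is padded by `4 / 4`.
violation-weight : ∀ {n} (s : State n) C → length (literals C) ≤ 2 →
  (∀ (x : Fin n) → arrs s denominators-1 (toℕ x) ≡ 3) →
  violation (currentQuery s) C ≡ sixteenths (weight (arrs s numerators) C)
violation-weight s C ≤2 d≡3 = go (literals C) ≤2
  where
  f = arrs s numerators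

  probFalse-quarters : ∀ ℓ → probFalse (currentQuery s) ℓ ≡ quarters (litFalsity f ℓ)
  probFalse-quarters ℓ rewrite d≡3 (var ℓ) =
    fraction-quarters (positive ℓ) (f (toℕ (var ℓ)))

  go : ∀ ℓs → length ℓs ≤ 2 →
       foldr (λ ℓ p → probFalse (currentQuery s) ℓ ℚ.* p) 1ℚ ℓs ≡
       sixteenths (listWeight f ℓs)
  go [] _ = sym sixteenths-16
  go (ℓ ∷ []) _ = trans
    (cong₂ ℚ._*_ (probFalse-quarters ℓ) (sym quarters-4)) (quarters-* (litFalsity f ℓ) 4)
  go (ℓ ∷ ℓ′ ∷ []) _ = trans
    (cong₂ (λ a b → a ℚ.* b) (probFalse-quarters ℓ)
      (trans (ℚ.*-identityʳ _) (probFalse-quarters ℓ′)))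
    (quarters-* (litFalsity f ℓ) (litFalsity f ℓ′))
  go (_ ∷ _ ∷ _ ∷ _) (s≤s (s≤s ()))

level≢2 : ∀ b → level b ≢ 2
level≢2 false ()
level≢2 true  ()

falsity≤4 : ∀ u y → falsity u y ≤ 4
falsity≤4 true  y = m∸n≤m 4 y
falsity≤4 false y = m⊓n≤n y 4

falsity-level : ∀ u → falsity u (level u) ≡ 0
falsity-level true  = refl
falsity-level false = refl

falsity-level-not : ∀ u → falsity u (level (not u)) ≡ 4
falsity-level-not true  = refl
falsity-level-not false = refl

falsity-2 : ∀ u → falsity u 2 ≡ 2
falsity-2 true  = refl
falsity-2 false = refl

falsity≡0⇒ : ∀ u y → falsity u y ≡ 0 → not (y ≡ᵇ 0) ≡ u
falsity≡0⇒ true  (suc y) _ = refl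
falsity≡0⇒ false zero    _ = refl

0<falsity-level⇒ : ∀ u t → 0 < falsity u (level t) → level (not u) ≡ level t
0<falsity-level⇒ true  false _ = refl
0<falsity-level⇒ false true  _ = refl

module _ {n : ℕ} (f : ℕ → ℕ) where

  weight-cong : ∀ {g} (C : Clause n) → (∀ (x : Fin n) → f (toℕ x) ≡ g (toℕ x)) →
                weight f C ≡ weight g C
  weight-cong {g} C f≗g = go (literals C)
    where
    go : ∀ ℓs → listWeight f ℓs ≡ listWeight g ℓs
    go []           = refl
    go (ℓ ∷ [])     = cong (λ y → falsity (positive ℓ) y * 4) (f≗g (var ℓ))
    go (ℓ ∷ ℓ′ ∷ _) = cong₂ (λ y y′ → falsity (positive ℓ) y * falsity (positive ℓ′) y′)
                        (f≗g (var ℓ)) (f≗g (var ℓ′))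

  -- Each factor of the weight is at most 4, so a product above `t * 4` needs both factors above
  -- `t`.
  <weight⇒<falsity : ∀ t {ℓs : List (Literal n)} → length ℓs ≤ 2 →
                     t * 4 < listWeight f ℓs → All (λ ℓ → t < litFalsity f ℓ) ℓs
  <weight⇒<falsity t {[]} _ _ = []
  <weight⇒<falsity t {ℓ ∷ []} _ t4< = *-cancelʳ-< 4 t _ t4< ∷ []
  <weight⇒<falsity t {ℓ ∷ ℓ′ ∷ []} _ t4< =
    *-cancelʳ-< 4 t _ (<-≤-trans t4< 
      (*-monoʳ-≤ (litFalsity f ℓ) (falsity≤4 (positive ℓ′) _))) ∷
    *-cancelʳ-< 4 t _ (<-≤-trans t4<
      (≤-trans (*-monoˡ-≤ (litFalsity f ℓ′) (falsity≤4 (positive ℓ) _))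
               (≤-reflexive (*-comm 4 (litFalsity f ℓ′))))) ∷ []
  <weight⇒<falsity t {_ ∷ _ ∷ _ ∷ _} (s≤s (s≤s ())) _

  -- A missing literal counts as falsity 4, hence the condition `t ≤ 4`. The values 3 and 4 of `t`
  -- give the thresholds 9 and 16.
  ≤falsity⇒≤weight : ∀ t {ℓs : List (Literal n)} → t ≤ 4 →
                     All (λ ℓ → t ≤ litFalsity f ℓ) ℓs → t * t ≤ listWeight f ℓs
  ≤falsity⇒≤weight t t≤4 []             = *-mono-≤ t≤4 t≤4
  ≤falsity⇒≤weight t t≤4 (t≤ ∷ [])      = *-mono-≤ t≤ t≤4
  ≤falsity⇒≤weight t t≤4 (t≤ ∷ t≤′ ∷ _) = *-mono-≤ t≤ t≤′

  weight≡0⇒ : ∀ {ℓs : List (Literal n)} → listWeight f ℓs ≡ 0 →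
              Any (λ ℓ → litFalsity f ℓ ≡ 0) ℓs
  weight≡0⇒ {ℓ ∷ []} w≡0 with m*n≡0⇒m≡0∨n≡0 (litFalsity f ℓ) w≡0
  ... | inj₁ eq = here eq
  weight≡0⇒ {ℓ ∷ ℓ′ ∷ _} w≡0 with m*n≡0⇒m≡0∨n≡0 (litFalsity f ℓ) w≡0
  ... | inj₁ eq = here eq
  ... | inj₂ eq = there (here eq)

-- Stated for an arbitrary numerator function, so that the reply to the array in memory can be
-- transported to an ideal query agreeing with it on the variables.
data Verdict {n m} (Φ : Formula n m) (f : ℕ → ℕ) : ℕ → Set where
  satisfied : (∀ j → weight f (Φ j) ≡ 0) → Verdict Φ f 0
  worst     : ∀ j → 0 < weight f (Φ j) →
              (∀ k → weight f (Φ k) ≤ weight f (Φ j)) → Verdict Φ f (suc (toℕ j))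

verdict : ∀ {n m} {Φ : Formula n m} → Is2SAT Φ → (O : Oracle Φ) (s : State n) →
  (∀ (x : Fin n) → arrs s denominators-1 (toℕ x) ≡ 3) →
  Verdict Φ (arrs s numerators) (encodeAnswer (answer O (past s) (currentQuery s)))
verdict {n} {Φ = Φ} is2 O s d≡3 =
  convert (answer O (past s) (currentQuery s)) (sound O (past s) (currentQuery s))
  where
  w : Clause n → ℕ
  w = weight (arrs s numerators)

  violation≡ : ∀ j → violation (currentQuery s) (Φ j) ≡ sixteenths (w (Φ j))
  violation≡ j = violation-weight s (Φ j) (is2 j) d≡3

  convert : ∀ ans → WorstViolated Φ (currentQuery s) ans →
            Verdict Φ (arrs s numerators) (encodeAnswer ans)
  convert nothing  all0 = satisfied λ j → sixteenths≡0 (trans (sym (violation≡ j)) (all0 j))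
  convert (just j) (¬all0 , max) = worst j (n≢0⇒n>0 w≢0) w≤
    where
    w≤ : ∀ k → w (Φ k) ≤ w (Φ j)
    w≤ k = sixteenths-reflects-≤
      (subst₂ ℚ._≤_ (violation≡ k) (violation≡ j) (max k))

    -- If the maximal clause had weight 0, all clauses would, and the oracle could not have answered
    -- `just`.
    w≢0 : w (Φ j) ≢ 0
    w≢0 ≡0 = ¬all0 λ k → trans (violation≡ k)
      (trans (cong sixteenths (n≤0⇒n≡0 (subst (w (Φ k) ≤_) ≡0 (w≤ k)))) sixteenths-0)

-- Probing literals

verdict-cong : ∀ {n m} {Φ : Formula n m} {f g r} →
  (∀ (x : Fin n) → f (toℕ x) ≡ g (toℕ x)) → Verdict Φ f r → Verdict Φ g r
verdict-cong {Φ = Φ} {f} f≗g (satisfied all0) =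
  satisfied λ j → trans (sym (weight-cong f (Φ j) f≗g)) (all0 j)
verdict-cong {Φ = Φ} {f} f≗g (worst j w>0 w≤) = worst j
  (subst (0 <_) (weight-cong f (Φ j) f≗g) w>0)
  (λ k → subst₂ _≤_ (weight-cong f (Φ k) f≗g) (weight-cong f (Φ j) f≗g) (w≤ k))

level-injective : ∀ {t u} → level t ≡ level u → t ≡ u
level-injective {false} {false} _ = refl
level-injective {true}  {true}  _ = refl

-- The pair (i , v) encodes the literal on variable i that is falsified by the numerator v.
Code : ∀ {n} → Literal n → ℕ → ℕ → Set
Code ℓ i v = toℕ (var ℓ) ≡ i × level (not (positive ℓ)) ≡ v

Code-injective : ∀ {n} {ℓ ℓ′ : Literal n} {i v} → Code ℓ i v → Code ℓ′ i v → ℓ ≡ ℓ′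
Code-injective (refl , refl) (i≡ , v≡) = cong₂ literal
  (toℕ-injective (sym i≡)) (not-injective (level-injective (sym v≡)))

-- Inclusion only: a unit clause on either literal qualifies too. Equal codes express a probe of a
-- single literal.
Within : ∀ {n} (i v k w : ℕ) → Clause n → Set
Within i v k w C = All (λ ℓ → Code ℓ i v ⊎ Code ℓ k w) (literals C)

-- If `i` and `k` coincide, the value `v` prevails.
probe : (i v k w p : ℕ) → ℕ → ℕ
probe i v k w p = update i v (update k w (λ _ → p))

-- The background value `p` is quantified inside the cases, so that one case distinction serves the
-- pure and the leaning queries alike.
probe-cases : ∀ i v k w x →
  (i ≡ x × ∀ p → probe i v k w p x ≡ v) ⊎
  (k ≡ x × ∀ p → probe i v k w p x ≡ w) ⊎
  (∀ p → probe i v k w p x ≡ p)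
probe-cases i v k w x with i ≟ x | k ≟ x
... | yes refl | _        = inj₁ (refl , λ p → update-same (update k w (λ _ → p)) i)
... | no i≢x   | yes refl = inj₂ (inj₁ (refl , λ p → trans (update-other (update k w (λ _ → p)) i≢x) (update-same (λ _ → p) k)))
... | no i≢x   | no k≢x   = inj₂ (inj₂ λ p → trans (update-other (update k w (λ _ → p)) i≢x) (update-other (λ _ → p) k≢x))

-- The probability 1/4 or 3/4 next to the truth value.
lean : Bool → ℕ
lean false = 1
lean true  = 3

falsified⇒lean : ∀ u c → 0 < falsity u (level c) → 3 ≤ falsity u (lean c)
falsified⇒lean true  false _ = ≤-refl
falsified⇒lean false true  _ = ≤-refl

-- The falsities under 1/4 and 3/4 add up to 4, so it is absurd that both exceed 2.
lean-one-sided : ∀ u → 2 < falsity u (lean false) → 2 < falsity u (lean true) → ∀ {A : Set} → A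
lean-one-sided true  _ (s≤s ())
lean-one-sided false (s≤s ()) _

lean<4 : ∀ u c → ¬ (3 < falsity u (lean c))
lean<4 true  false (s≤s (s≤s (s≤s ())))
lean<4 true  true  (s≤s ())
lean<4 false false (s≤s ())
lean<4 false true  (s≤s (s≤s (s≤s ())))

module Identification {n m} (Φ : Formula n m) (is2 : Is2SAT Φ) where

  module _ (i : ℕ) (t : Bool) (k : ℕ) (u : Bool) where
    private
      assign : ℕ → ℕ → ℕ
      assign = probe i (level t) k (level u)

      In : Literal n → Set
      In ℓ = Code ℓ i (level t) ⊎ Code ℓ k (level u)

      classify : ∀ (ℓ : Literal n) → (∃ λ y → ∀ p → assign p (toℕ (var ℓ)) ≡ level y ×
                   (0 < falsity (positive ℓ) (level y) → In ℓ)) ⊎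
                 (∀ p → assign p (toℕ (var ℓ)) ≡ p)
      classify ℓ with probe-cases i (level t) k (level u) (toℕ (var ℓ))
      ... | inj₁ (i≡x , eq)        = inj₁ (t , λ p → eq p ,
              λ >0 → inj₁ (sym i≡x , 0<falsity-level⇒ (positive ℓ) t >0))
      ... | inj₂ (inj₁ (k≡x , eq)) = inj₁ (u , λ p → eq p ,
              λ >0 → inj₂ (sym k≡x , 0<falsity-level⇒ (positive ℓ) u >0))
      ... | inj₂ (inj₂ eq)         = inj₂ eq

    Blocked : Bool → Set
    Blocked c = ∃ λ j → 0 < weight (assign (level c)) (Φ j)

    -- In a clause violated by a pure query every literal has falsity 4. Leaning lowers this to 3 on
    -- unprobed variables and keeps it on probed ones, and `3 * 3 = 9`.
    blocked-heavy : ∀ c ((j , _) : Blocked c) → 9 ≤ weight (assign (lean c)) (Φ j)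
    blocked-heavy c (j , >0) = ≤falsity⇒≤weight (assign (lean c)) 3 {literals (Φ j)} (n≤1+n 3)
      (All.map (λ {ℓ} → heavy ℓ) (<weight⇒<falsity (assign (level c)) 0 (is2 j) >0))
      where
      heavy : ∀ ℓ → 0 < litFalsity (assign (level c)) ℓ → 3 ≤ litFalsity (assign (lean c)) ℓ
      heavy ℓ >0 with classify ℓ
      ... | inj₁ (y , eq) rewrite proj₁ (eq (level c)) | proj₁ (eq (lean c))
            | sym (0<falsity-level⇒ (positive ℓ) y >0)
            | falsity-level-not (positive ℓ) = n≤1+n 3
      ... | inj₂ eq rewrite eq (level c) | eq (lean c) = falsified⇒lean (positive ℓ) c >0

    -- A reply common to both leanings has weight at least 9, hence only literals of falsity at
    -- least 3, whereas an unprobed literal has falsity 1 under one of the leanings.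
    agreement⇒within : (∀ c → Blocked c) → ∀ j →
      (∀ c k → weight (assign (lean c)) (Φ k) ≤ weight (assign (lean c)) (Φ j)) →
      Within i (level t) k (level u) (Φ j)
    agreement⇒within blocked j maximal =
      All.zipWith (λ {ℓ} (>2 , >2′) → inside ℓ >2 >2′) (likely false , likely true)
      where
      likely : ∀ c → All (λ ℓ → 2 < litFalsity (assign (lean c)) ℓ) (literals (Φ j))
      likely c = <weight⇒<falsity (assign (lean c)) 2 (is2 j)
        (≤-trans (blocked-heavy c (blocked c)) (maximal c _))

      inside : ∀ ℓ → 2 < litFalsity (assign (lean false)) ℓ →
               2 < litFalsity (assign (lean true)) ℓ → In ℓ
      inside ℓ >2 >2′ with classify ℓ
      ... | inj₁ (y , eq) = proj₂ (eq 1) (subst (λ z → 0 < falsity (positive ℓ) z)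
              (proj₁ (eq 1)) (≤-trans (s≤s z≤n) >2))
      ... | inj₂ eq rewrite eq 1 | eq 3 = lean-one-sided (positive ℓ) >2 >2′

    -- If the two variables coincide, the compatibility hypothesis makes both codes ask for the same
    -- value; otherwise the prevailing value would satisfy a literal with the other code.
    within⇒heavy : (i ≡ k → t ≡ u) → ∀ p j → Within i (level t) k (level u) (Φ j) →
                   16 ≤ weight (assign p) (Φ j)
    within⇒heavy compatible p j within =
      ≤falsity⇒≤weight (assign p) 4 ≤-refl (All.map (λ {ℓ} → falsified ℓ) within)
      where
      falsified : ∀ ℓ → In ℓ → 4 ≤ litFalsity (assign p) ℓ
      falsified ℓ (inj₁ (refl , v≡)) = ≤-reflexive (sym (trans
        (cong (falsity (positive ℓ)) (trans (update-same (update k (level u) (λ _ → p)) i) (sym v≡)))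
        (falsity-level-not (positive ℓ))))
      falsified ℓ (inj₂ (refl , w≡)) with i ≟ k
      ... | yes refl = falsified ℓ (inj₁ (refl , trans w≡ (cong level (sym (compatible refl)))))
      ... | no i≢k   = ≤-reflexive (sym (trans
        (cong (falsity (positive ℓ)) (trans (update-other (update k (level u) (λ _ → p)) i≢k)
          (trans (update-same (λ _ → p) k) (sym w≡))))
        (falsity-level-not (positive ℓ))))

    -- Certain violation needs falsity 4 in every literal, which an unprobed variable at 1/4 or 3/4
    -- cannot supply.
    heavy⇒within : ∀ c j → 16 ≤ weight (assign (lean c)) (Φ j) →
                   Within i (level t) k (level u) (Φ j)
    heavy⇒within c j 16≤ =
      All.map (λ {ℓ} → inside ℓ) (<weight⇒<falsity (assign (lean c)) 3 (is2 j)
        -- A weight above `3 * 4` is required, that is at least 13, and `16 = 3 + 13`.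
        (≤-trans (m≤n+m 13 3) 16≤))
      where
      inside : ∀ ℓ → 3 < litFalsity (assign (lean c)) ℓ → In ℓ
      inside ℓ >3 with classify ℓ
      ... | inj₁ (y , eq) = proj₂ (eq (lean c)) (subst (λ z → 0 < falsity (positive ℓ) z)
              (proj₁ (eq (lean c))) (≤-trans (s≤s z≤n) >3))
      ... | inj₂ eq rewrite eq (lean c) = contradiction >3 (lean<4 (positive ℓ) c)

    -- The only clause within the probe has full weight 16. So has any worst clause, which therefore
    -- lies within the probe as well, and nothing is left to tie-breaking.
    unique⇒verdict : (i ≡ k → t ≡ u) → ∀ c j → Within i (level t) k (level u) (Φ j) →
      (∀ j′ → Within i (level t) k (level u) (Φ j′) → j′ ≡ j) →
      ∀ {r} → Verdict Φ (assign (lean c)) r → r ≡ suc (toℕ j)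
    unique⇒verdict compatible c j within unique (satisfied all0) =
      contradiction (subst (16 ≤_) (all0 j) (within⇒heavy compatible (lean c) j within)) λ ()
    unique⇒verdict compatible c j within unique (worst j′ _ w≤) =
      cong (suc ∘ toℕ) (unique j′ (heavy⇒within c j′
        (≤-trans (within⇒heavy compatible (lean c) j within) (w≤ j))))

  -- Shapes of clauses and uniqueness of the probed clause

  Unit : Literal n → Set
  Unit ℓ = ∃ λ j → literals (Φ j) ≡ ℓ ∷ []

  distinct : ∀ {j ℓ ℓ′ ℓs} → literals (Φ j) ≡ ℓ ∷ ℓ′ ∷ ℓs → var ℓ ≢ var ℓ′
  distinct {j} eq var≡ with literals (Φ j) | distinctVars (Φ j)
  distinct refl var≡ | _ | ((≢ ∷ _) ∷ _) = ≢ var≡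

  data Shape (j : Fin m) : Set where
    unit : ∀ ℓ → literals (Φ j) ≡ ℓ ∷ [] → Shape j
    pair : ∀ ℓ ℓ′ → literals (Φ j) ≡ ℓ ∷ ℓ′ ∷ [] → Shape j

  -- Satisfiability excludes the empty clause.
  shape : Satisfiable Φ → ∀ j → Shape j
  shape (σ , sat) j = go (literals (Φ j)) refl (is2 j) (sat j)
    where
    go : ∀ ℓs → literals (Φ j) ≡ ℓs → length ℓs ≤ 2 →
         Any (λ ℓ → σ (var ℓ) ≡ positive ℓ) ℓs → Shape j
    go (ℓ ∷ [])        eq _ _ = unit ℓ eq
    go (ℓ ∷ ℓ′ ∷ [])   eq _ _ = pair ℓ ℓ′ eq
    go (_ ∷ _ ∷ _ ∷ _) eq (s≤s (s≤s ())) _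

  module _ (rf : RepetitionFree Φ) (satisfiable : Satisfiable Φ) where

    private
      same-literals : ∀ {j j′ ℓs} → literals (Φ j) ≡ ℓs → literals (Φ j′) ≡ ℓs → j′ ≡ j
      same-literals {j} {j′} eq eq′ = rf j′ j
        (mk⇔ (subst (_ ∈_) (trans eq′ (sym eq))) (subst (_ ∈_) (trans eq (sym eq′))))

      -- Repetition-freeness compares clauses as sets, so it also applies when the literals are
      -- listed in opposite orders.
      swapped-literals : ∀ {j j′ ℓ ℓ′} → literals (Φ j) ≡ ℓ ∷ ℓ′ ∷ [] →
                         literals (Φ j′) ≡ ℓ′ ∷ ℓ ∷ [] → j′ ≡ j
      swapped-literals {j} {j′} eq eq′ = rf j′ j
        (mk⇔ (subst (_ ∈_) (sym eq) ∘ swap ∘ subst (_ ∈_) eq′)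
             (subst (_ ∈_) (sym eq′) ∘ swap ∘ subst (_ ∈_) eq))
        where
        swap : ∀ {x a b : Literal n} → x ∈ a ∷ b ∷ [] → x ∈ b ∷ a ∷ []
        swap (here x≡)         = there (here x≡)
        swap (there (here x≡)) = here x≡

    falsifier : Literal n → ℕ
    falsifier ℓ = level (not (positive ℓ))

    -- A clause within the probe is either a unit clause on one of the two literals, which is
    -- excluded, or contains both in some order, since distinct variables forbid the same literal
    -- twice.
    pair-unique : ∀ {j ℓ ℓ′} → literals (Φ j) ≡ ℓ ∷ ℓ′ ∷ [] → ¬ Unit ℓ → ¬ Unit ℓ′ →
      ∀ j′ → Within (toℕ (var ℓ)) (falsifier ℓ) (toℕ (var ℓ′)) (falsifier ℓ′) (Φ j′) → j′ ≡ j
    pair-unique {j} {ℓ} {ℓ′} eq ¬unit ¬unit′ j′ within with shape satisfiable j′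
    ... | unit x eq′ with subst (All _) eq′ within
    ... | inj₁ c ∷ [] = contradiction
            (j′ , trans eq′ (cong (_∷ []) (Code-injective c (refl , refl)))) ¬unit
    ... | inj₂ c ∷ [] = contradiction
            (j′ , trans eq′ (cong (_∷ []) (Code-injective c (refl , refl)))) ¬unit′
    pair-unique {j} {ℓ} {ℓ′} eq ¬unit ¬unit′ j′ within
        | pair x y eq′ with subst (All _) eq′ within
    ... | inj₁ c ∷ inj₁ d ∷ [] =
            contradiction (cong var (Code-injective c d)) (distinct eq′)
    ... | inj₂ c ∷ inj₂ d ∷ [] =
            contradiction (cong var (Code-injective c d)) (distinct eq′)
    ... | inj₁ c ∷ inj₂ d ∷ [] = same-literals eq (trans eq′
            (cong₂ (λ a b → a ∷ b ∷ []) (Code-injective c (refl , refl))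
                                        (Code-injective d (refl , refl))))
    ... | inj₂ c ∷ inj₁ d ∷ [] = swapped-literals eq (trans eq′
            (cong₂ (λ a b → a ∷ b ∷ []) (Code-injective c (refl , refl))
                                        (Code-injective d (refl , refl))))

    unit-unique : ∀ {j ℓ} → literals (Φ j) ≡ ℓ ∷ [] →
      ∀ j′ → Within (toℕ (var ℓ)) (falsifier ℓ) (toℕ (var ℓ)) (falsifier ℓ) (Φ j′) → j′ ≡ j
    unit-unique {j} {ℓ} eq j′ within with shape satisfiable j′
    ... | unit x eq′ with subst (All _) eq′ within
    ... | c ∷ [] = same-literals eq
            (trans eq′ (cong (_∷ []) (Code-injective (Sum.reduce c) (refl , refl))))
    unit-unique {j} {ℓ} eq j′ within | pair x y eq′ with subst (All _) eq′ within
    ... | c ∷ d ∷ [] =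
            contradiction (cong var (Code-injective (Sum.reduce c) (Sum.reduce d))) (distinct eq′)

  -- A table entry orders the two literals in its own way, possibly opposite to the clause; weight
  -- and satisfaction are restated in the order of the entry.
  record Spelled (j : Fin m) (i v k w : ℕ) : Set where
    field
      {first second} : Literal n
      first-code     : Code first i v
      second-code    : Code second k w
      weight-product : ∀ f → weight f (Φ j) ≡ litFalsity f first * litFalsity f second
      one-holds      : ∀ σ → Satisfies σ Φ →
                       σ (var first) ≡ positive first ⊎ σ (var second) ≡ positive second

  spell : ∀ {j ℓ ℓ′ i v k w} → literals (Φ j) ≡ ℓ ∷ ℓ′ ∷ [] → Within i v k w (Φ j) →
          Spelled j i v k w
  spell {j} {ℓ} {ℓ′} eq within = case subst (All _) eq within of λ
    { (inj₁ c ∷ inj₁ d ∷ []) → contradiction (cong var (Code-injective c d)) (distinct eq)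
    ; (inj₂ c ∷ inj₂ d ∷ []) → contradiction (cong var (Code-injective c d)) (distinct eq)
    ; (inj₁ c ∷ inj₂ d ∷ []) → record
        { first-code = c ; second-code = d
        ; weight-product = λ f → cong (listWeight f) eq
        ; one-holds = holds }
    ; (inj₂ c ∷ inj₁ d ∷ []) → record
        { first-code = d ; second-code = c
        ; weight-product = λ f → trans (cong (listWeight f) eq)
                                   (*-comm (litFalsity f ℓ) (litFalsity f ℓ′))
        ; one-holds = λ σ sat → Sum.swap (holds σ sat) } }
    where
    holds : ∀ σ → Satisfies σ Φ → σ (var ℓ) ≡ positive ℓ ⊎ σ (var ℓ′) ≡ positive ℓ′
    holds σ sat with subst (Any _) eq (sat j)
    ... | here p         = inj₁ p
    ... | there (here p) = inj₂ p

-- Learning the clauses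

rowIndex columnIndex scanIndex anchorIndex reply solvedFlag : Reg
rowIndex    = 1
columnIndex = 2
scanIndex   = 3
anchorIndex = 4
reply       = 5
solvedFlag  = 6

replies variable₁ falsifier₁ variable₂ falsifier₂ : Arr
replies    = 3
variable₁  = 4
falsifier₁ = 5
variable₂  = 6
falsifier₂ = 7

-- The absolute difference, used as an equality test.
difference : Expr → Expr → Expr
difference e f = (e ⊖ f) ⊕ (f ⊖ e)

unlessSolved : Prog → Prog
unlessSolved p = if≢0 reg solvedFlag then skip else p

fill : ℕ → Prog
fill p = for scanIndex (numerators [ reg scanIndex ]≔ const p)

-- A diagonal row probes single literals, any other row the pairs with a fixed variable.
anchor : Bool → Reg
anchor diagonal = if diagonal then columnIndex else rowIndex

module _ (diagonal t u : Bool) where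

  -- The anchor is written last, so that its value prevails on coinciding variables, as in `probe`.
  ask-probe : Prog
  ask-probe =
    anchorIndex ≔ reg (anchor diagonal) ⨟
    numerators [ reg columnIndex ]≔ const (level u) ⨟
    numerators [ reg anchorIndex ]≔ const (level t) ⨟
    query reply

  -- Undoing two entries takes constant time; a new `fill` for each query would make a row
  -- quadratic.
  restore : ℕ → Prog
  restore p =
    numerators [ reg columnIndex ]≔ const p ⨟ numerators [ reg anchorIndex ]≔ const p

  -- After the reply 0 the numerators are left as they are, because they hold a satisfying
  -- assignment.
  pureStep : Bool → Prog
  pureStep c = unlessSolved (ask-probe ⨟
    if≢0 reg reply then restore (level c) else (solvedFlag ≔ const 1))

  purePass : Bool → Prog
  purePass c = fill (level c) ⨟ for columnIndex (pureStep c)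

  lowStep : Prog
  lowStep = ask-probe ⨟ restore (lean false) ⨟ replies [ reg columnIndex ]≔ reg reply

  lowPass : Prog
  lowPass = fill (lean false) ⨟ for columnIndex lowStep

  -- A clause found on the diagonal is a unit clause whose literal is false at `level t`, so its
  -- variable receives the opposite value.
  assign-variable : Prog
  assign-variable =
    if diagonal then outputs [ reg columnIndex ]≔ const (level (not t)) else skip

  -- The reply, which is the clause number plus one, serves as the table index.
  record-clause : Prog
  record-clause =
    variable₁ [ reg reply ]≔ reg anchorIndex ⨟
    falsifier₁ [ reg reply ]≔ const (level t) ⨟
    variable₂ [ reg reply ]≔ reg columnIndex ⨟
    falsifier₂ [ reg reply ]≔ const (level u) ⨟
    assign-variable

  compare-replies : Prog
  compare-replies =
    if≢0 difference (reg reply) (replies [ reg columnIndex ]) then skip else record-clause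

  highStep : Prog
  highStep = ask-probe ⨟ restore (lean true) ⨟ compare-replies

  highPass : Prog
  highPass = fill (lean true) ⨟ for columnIndex highStep

  -- The leaning passes are conclusive once both pure passes have found every column blocked. The
  -- passes are separate because changing the background touches every variable.
  row : Prog
  row = purePass false ⨟
    unlessSolved (purePass true ⨟ unlessSolved (lowPass ⨟ highPass))

rows : List (Bool × Bool) → Prog
rows = foldr (λ (t , u) p → unlessSolved (row false t u) ⨟ p) skip

signs : List (Bool × Bool)
signs = (false , false) ∷ (false , true) ∷ (true , false) ∷ (true , true) ∷ []

identify : Prog
identify =
  -- The entry 3 encodes the denominator 4; the output 2, halfway between the levels 0 and 4, means
  -- unassigned.
  for scanIndex (denominators-1 [ reg scanIndex ]≔ const 3 ⨟
                 outputs [ reg scanIndex ]≔ const 2) ⨟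
  row true false false ⨟
  unlessSolved (row true true true) ⨟
  for rowIndex (rows signs)

-- The data on which later stages rely, bundled so that its preservation is a single equation.
-- Numerators and replies are refreshed by each row.
record Memory : Set where
  constructor memory
  field
    denoms assigned var₁ fal₁ var₂ fal₂ : ℕ → ℕ

open Memory

mem : ∀ {n} → State n → Memory
mem s = memory (arrs s denominators-1) (arrs s outputs)
  (arrs s variable₁) (arrs s falsifier₁) (arrs s variable₂) (arrs s falsifier₂)

difference≡0 : ∀ {a b} → a ≡ b → (a ∸ b) + (b ∸ a) ≡ 0
difference≡0 {a} refl = cong₂ _+_ (n∸n≡0 a) (n∸n≡0 a)

difference≡0⇒ : ∀ a b → (a ∸ b) + (b ∸ a) ≡ 0 → a ≡ b
difference≡0⇒ a b eq = ≤-antisym (m∸n≡0⇒m≤n (m+n≡0⇒m≡0 (a ∸ b) eq))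
                                 (m∸n≡0⇒m≤n (m+n≡0⇒n≡0 (a ∸ b) eq))

update-cong : ∀ {A : Set} (f g : ℕ → A) i {v} x → f x ≡ g x →
              update i v f x ≡ update i v g x
update-cong f g i x = cong (if i ≡ᵇ x then _ else_)

update-preserves : ∀ {A : Set} (P : A → Set) (f : ℕ → A) i {v} x → P v → P (f x) →
                   P (update i v f x)
update-preserves P f i x pv pf with update-cases f i x
... | inj₁ (_ , eq) = subst P (sym eq) pv
... | inj₂ (_ , eq) = subst P (sym eq) pf

all-below-suc : ∀ {P : ℕ → Set} {k} → (∀ i → i < k → P i) → P k → ∀ i → i < suc k → P i
all-below-suc below at i i<1+k with m<1+n⇒m<n∨m≡n i<1+k
... | inj₁ i<k  = below i i<k
... | inj₂ refl = at

verdict-0 : ∀ {n m} {Φ : Formula n m} {f r} → Verdict Φ f r → r ≡ 0 →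
            ∀ j → weight f (Φ j) ≡ 0
verdict-0 (satisfied all0) _ = all0

verdict-≢0 : ∀ {n m} {Φ : Formula n m} {f r} → Verdict Φ f r → r ≢ 0 →
             ∃ λ j → 0 < weight f (Φ j)
verdict-≢0 (satisfied _)  ≢0 = contradiction refl ≢0
verdict-≢0 (worst j >0 _) _  = j , >0

-- Correctness of the identification

module Identify {n m} {Φ : Formula n m} (is2 : Is2SAT Φ)
                (σ : Fin n → Bool) (sat : Satisfies σ Φ) (O : Oracle Φ) where

  open Hoare O
  open Identification Φ is2

  Filled : ℕ → State n → Set
  Filled p s = ∀ x → x < n → arrs s numerators x ≡ p

  fill-rule : ∀ p {Q s} → regs s inputReg ≡ n →
    (∀ s′ → regs s′ inputReg ≡ n → mem s′ ≡ mem s → regs s′ rowIndex ≡ regs s rowIndex →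
      regs s′ solvedFlag ≡ regs s solvedFlag → arrs s′ replies ≡ arrs s replies →
      Filled p s′ → Q s′) →
    wp (fill p) Q s
  fill-rule p {s = s} in≡n exit = for-rule scanIndex refl (numerators [ reg scanIndex ]≔ const p)
    (λ k s′ → mem s′ ≡ mem s × regs s′ rowIndex ≡ regs s rowIndex ×
       regs s′ solvedFlag ≡ regs s solvedFlag × arrs s′ replies ≡ arrs s replies ×
       (∀ x → x < k → arrs s′ numerators x ≡ p))
    (λ { k s′ k<n refl in≡n′ (m≡ , r≡ , f≡ , a≡ , filled) →
      refl , in≡n′ , m≡ , r≡ , f≡ , a≡ ,
      all-below-suc
        (λ x x<k → update-preserves (_≡ p) (arrs s′ numerators) k x refl (filled x x<k))
        (update-same (arrs s′ numerators) k) })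
    in≡n (refl , refl , refl , refl , λ _ ())
    (λ { s′ in≡n′ (m≡ , r≡ , f≡ , a≡ , filled) → exit s′ in≡n′ m≡ r≡ f≡ a≡ filled })

  Solved : State n → Set
  Solved s = ∀ j → weight (arrs s numerators) (Φ j) ≡ 0

  Outcome : (State n → Set) → State n → Set
  Outcome P s = (regs s solvedFlag ≢ 0 × Solved s) ⊎ (regs s solvedFlag ≡ 0 × P s)

  -- Turns the alternative into the pair of implications that `wp` asks for at a test of the flag.
  outcome-cases : ∀ {A B C : Set} {flag} {s : State n} →
    (flag ≢ 0 × Solved s) ⊎ (flag ≡ 0 × A) →
    (flag ≢ 0 → Solved s → B) → (flag ≡ 0 → A → C) → (flag ≢ 0 → B) × (flag ≡ 0 → C)
  outcome-cases (inj₁ (≢0 , solved)) f _ =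
    (λ _ → f ≢0 solved) , λ ≡0 → contradiction ≡0 ≢0
  outcome-cases (inj₂ (≡0 , a)) _ g =
    (λ ≢0 → contradiction ≡0 ≢0) , λ _ → g ≡0 a

  -- Agreement with the fixed satisfying `σ` can be maintained because a variable is assigned only
  -- when a unit clause forces its value.
  record Sound (M : Memory) : Set where
    field
      denoms≡3   : ∀ (x : Fin n) → denoms M (toℕ x) ≡ 3
      consistent : ∀ (x : Fin n) → assigned M (toℕ x) ≡ 2 ⊎ assigned M (toℕ x) ≡ level (σ x)

  open Sound

  Entry : Memory → Fin m → Set
  Entry M j = Within (var₁ M r) (fal₁ M r) (var₂ M r) (fal₂ M r) (Φ j)
    where r = suc (toℕ j)

  infix 4 _≼_
  -- Growth of knowledge: what one row has learned survives the later rows, although entries may be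
  -- overwritten.
  record _≼_ (M M′ : Memory) : Set where
    field
      entries     : ∀ j → Entry M j → Entry M′ j
      assignments : ∀ x → assigned M x ≢ 2 → assigned M′ x ≢ 2

  open _≼_

  ≼-refl : ∀ {M} → M ≼ M
  ≼-refl = record { entries = λ _ → id ; assignments = λ _ → id }

  ≼-trans : ∀ {M M′ M″} → M ≼ M′ → M′ ≼ M″ → M ≼ M″
  ≼-trans p q = record { entries     = λ j → entries q j ∘ entries p j
                       ; assignments = λ x → assignments q x ∘ assignments p x }

  write : (r i v k w : ℕ) → Memory → Memory
  write r i v k w (memory d o v₁ f₁ v₂ f₂) =
    memory d o (update r i v₁) (update r v f₁) (update r k v₂) (update r w f₂)

  assign : (x v : ℕ) → Memory → Memory
  assign x v (memory d o v₁ f₁ v₂ f₂) = memory d (update x v o) v₁ f₁ v₂ f₂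

  write-entry : ∀ {r i v k w} M j → r ≡ suc (toℕ j) → Within i v k w (Φ j) →
                Entry (write r i v k w M) j
  write-entry {i = i} {v} {k} {w} (memory _ _ v₁ f₁ v₂ f₂) j refl within
    rewrite update-same v₁ (suc (toℕ j)) {i} | update-same f₁ (suc (toℕ j)) {v}
          | update-same v₂ (suc (toℕ j)) {k} | update-same f₂ (suc (toℕ j)) {w} = within

  -- The index `r` determines the clause, so an overwritten entry is replaced by another valid one
  -- for the same clause.
  write-≼ : ∀ {r i v k w} M j → r ≡ suc (toℕ j) → Within i v k w (Φ j) →
            M ≼ write r i v k w M
  write-≼ {r} {i} {v} {k} {w} M@(memory _ _ v₁ f₁ v₂ f₂) j r≡ within = record
    { entries = kept ; assignments = λ _ → id }
    where
    kept : ∀ j′ → Entry M j′ → Entry (write r i v k w M) j′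
    kept j′ entry with r ≟ suc (toℕ j′)
    ... | yes r≡′ = write-entry M j′ r≡′
          (subst (λ j → Within i v k w (Φ j))
            (toℕ-injective (suc-injective (trans (sym r≡) r≡′))) within)
    ... | no r≢   = subst id (sym (cong₂ (λ (a , b) (c , d) → Within a b c d (Φ j′))
          (cong₂ _,_ (update-other v₁ r≢) (update-other f₁ r≢))
          (cong₂ _,_ (update-other v₂ r≢) (update-other f₂ r≢)))) entry

  assign-≼ : ∀ {x v} M → v ≢ 2 → M ≼ assign x v M
  assign-≼ {x} M v≢2 = record
    { entries     = λ _ → id
    ; assignments = λ y → update-preserves (_≢ 2) (assigned M) x y v≢2 }

  module Row (diagonal t u : Bool) (diagonal⇒t≡u : diagonal ≡ true → t ≡ u) (i : ℕ) where

    at : ℕ → ℕ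
    at k = if diagonal then k else i

    anchor-at : ∀ (f : Reg → ℕ) {k} → f rowIndex ≡ i → f columnIndex ≡ k →
                f (anchor diagonal) ≡ at k
    anchor-at f {k} i≡ k≡ = go diagonal
      where
      go : ∀ d → f (anchor d) ≡ (if d then k else i)
      go true  = k≡
      go false = i≡

    Probe : ℕ → ℕ → ℕ → ℕ
    Probe k = probe (at k) (level t) k (level u)

    -- Conditional on uniqueness, since otherwise the oracle may name another clause. For the
    -- clauses that matter, `pair-unique` and `unit-unique` supply the condition.
    Learned : ℕ → Memory → Set
    Learned k M = ∀ j → (at k ≡ k → t ≡ u) →
      Within (at k) (level t) k (level u) (Φ j) →
      (∀ j′ → Within (at k) (level t) k (level u) (Φ j′) → j′ ≡ j) →
      Entry M j × (diagonal ≡ true → assigned M k ≢ 2)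

    Learned-≼ : ∀ {k M M′} → M ≼ M′ → Learned k M → Learned k M′
    Learned-≼ M≼ learned j c w q = let entry , assigned = learned j c w q in
      entries M≼ j entry , assignments M≼ _ ∘ assigned

    -- `actual-reply` concerns the array itself, as needed when the formula turns out satisfied;
    -- `probe-reply` concerns the ideal query with background `p`, to which the results on probes
    -- apply.
    record Asked (p k : ℕ) (s s′ : State n) : Set where
      field
        input-kept    : regs s′ inputReg ≡ n
        row-kept      : regs s′ rowIndex ≡ i
        column-kept   : regs s′ columnIndex ≡ k
        anchored      : regs s′ anchorIndex ≡ at k
        flag-kept     : regs s′ solvedFlag ≡ regs s solvedFlag
        mem-kept      : mem s′ ≡ mem s
        replies-kept  : arrs s′ replies ≡ arrs s replies
        actual-reply  : Verdict Φ (arrs s′ numerators) (regs s′ reply)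
        probe-reply   : Verdict Φ (Probe k p) (regs s′ reply)
        restorable    : ∀ x → x < n →
          update (regs s′ anchorIndex) p
            (update (regs s′ columnIndex) p (arrs s′ numerators)) x ≡ p

    open Asked

    ask-rule : ∀ {p k} Q s → Sound (mem s) → Filled p s → regs s inputReg ≡ n →
      regs s rowIndex ≡ i → regs s columnIndex ≡ k →
      (∀ s′ → Asked p k s s′ → Q s′) → wp (ask-probe diagonal t u) Q s
    ask-rule {p} {k} Q s sound filled in≡n i≡ k≡ exit = exit (ask O reply probing) record
      { input-kept   = in≡n
      ; row-kept     = i≡
      ; column-kept  = k≡
      ; anchored     = anchor-at (regs s) i≡ k≡
      ; flag-kept    = refl
      ; mem-kept     = refl
      ; replies-kept = refl
      ; actual-reply = actual
      ; probe-reply  = verdict-cong agree actual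
      ; restorable   = restored }
      where
      a = regs s (anchor diagonal)
      num = arrs s numerators
      probedNum = update a (level t) (update (regs s columnIndex) (level u) num)

      probing : State n
      probing = setArr numerators a (level t)
        (setArr numerators (regs s columnIndex) (level u) (setReg anchorIndex a s))

      actual : Verdict Φ probedNum (regs (ask O reply probing) reply)
      actual = verdict is2 O probing (denoms≡3 sound)

      agree : ∀ (x : Fin n) → probedNum (toℕ x) ≡ Probe k p (toℕ x)
      agree x = trans
        (cong₂ (λ a b → update a (level t) (update b (level u) num) (toℕ x))
          (anchor-at (regs s) i≡ k≡) k≡)
        (update-cong (update k (level u) num) (update k (level u) (λ _ → p)) (at k) (toℕ x)
          (update-cong num (λ _ → p) k (toℕ x) (filled (toℕ x) (toℕ<n x))))

      restored : ∀ x → x < n → update a p (update (regs s columnIndex) p probedNum) x ≡ p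
      restored x x<n
        with update-cases (update c p probedNum) a {p} x | update-cases probedNum c {p} x
           | update-cases (update c (level u) num) a {level t} x
           | update-cases num c {level u} x
        where c = regs s columnIndex
      ... | inj₁ (_ , eq) | _ | _ | _ = eq
      ... | inj₂ (_ , eq) | inj₁ (_ , eq′) | _ | _ = trans eq eq′
      -- The probe and its undoing write the same two indices, so an index left alone by the undoing
      -- was not probed.
      ... | inj₂ (a≢ , _) | inj₂ _ | inj₁ (a≡ , _) | _ = contradiction a≡ a≢
      ... | inj₂ _ | inj₂ (c≢ , _) | inj₂ _ | inj₁ (c≡ , _) = contradiction c≡ c≢
      ... | inj₂ (_ , e₁) | inj₂ (_ , e₂) | inj₂ (_ , e₃) | inj₂ (_ , e₄) =
            trans e₁ (trans e₂ (trans e₃ (trans e₄ (filled x x<n))))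

    PureInv : Memory → Bool → ℕ → State n → Set
    PureInv M c k s = regs s rowIndex ≡ i × Outcome (λ s → mem s ≡ M ×
      Filled (level c) s × (∀ k′ → k′ < k → Blocked (at k′) t k′ u c)) s

    purePass-rule : ∀ c {M Q s} → Sound M → regs s inputReg ≡ n → regs s rowIndex ≡ i →
      regs s solvedFlag ≡ 0 → mem s ≡ M →
      (∀ s′ → regs s′ inputReg ≡ n → regs s′ rowIndex ≡ i → Outcome (λ s′ → mem s′ ≡ M ×
         (∀ k → k < n → Blocked (at k) t k u c)) s′ → Q s′) →
      wp (purePass diagonal t u c) Q s
    purePass-rule c {M} sound in≡n i≡ unsolved m≡ exit =
      fill-rule (level c) in≡n λ s₁ in≡n₁ mem≡ i≡₁ flag≡ _ filled →
      for-rule columnIndex refl (pureStep diagonal t u c) (PureInv M c) step in≡n₁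
        (trans i≡₁ i≡ , inj₂ (trans flag≡ unsolved , trans mem≡ m≡ , filled , λ _ ()))
        (λ { s₂ in≡n₂ (i≡₂ , outcome) → exit s₂ in≡n₂ i≡₂
               (Sum.map₂ (λ { (f≡0 , mem≡ , _ , blocked) → f≡0 , mem≡ , blocked }) outcome) })
      where
      step : ∀ k s → k < n → regs s columnIndex ≡ k → regs s inputReg ≡ n → PureInv M c k s →
        wp (pureStep diagonal t u c)
           (Next columnIndex (PureInv M c) k) s
      step k s k<n k≡ in≡n (i≡ , outcome) = outcome-cases {s = s} outcome
        (λ ≢0 solved → k≡ , in≡n , i≡ , inj₁ (≢0 , solved))
        λ { ≡0 (mem≡ , filled , blocked) →
          ask-rule
            (wp (if≢0 reg reply then restore diagonal t u (level c) else (solvedFlag ≔ const 1))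
                (Next columnIndex (PureInv M c) k))
            s (subst Sound (sym mem≡) sound) filled in≡n i≡ k≡ λ s′ asked →
          (λ ≢0 → column-kept asked , input-kept asked , row-kept asked ,
             inj₂ (trans (flag-kept asked) ≡0 , trans (mem-kept asked) mem≡ , restorable asked ,
               all-below-suc blocked (verdict-≢0 (probe-reply asked) ≢0))) ,
          (λ ≡0′ → column-kept asked , input-kept asked , row-kept asked ,
             inj₁ ((λ ()) , verdict-0 (actual-reply asked) ≡0′)) }

    LowVerdict : State n → ℕ → Set
    LowVerdict s k = Verdict Φ (Probe k (lean false)) (arrs s replies k)

    LowInv : Memory → ℕ → State n → Set
    LowInv M k s = regs s rowIndex ≡ i × regs s solvedFlag ≡ 0 × mem s ≡ M ×
      Filled (lean false) s × (∀ k′ → k′ < k → LowVerdict s k′)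

    lowPass-rule : ∀ {M Q s} → Sound M → regs s inputReg ≡ n → regs s rowIndex ≡ i →
      regs s solvedFlag ≡ 0 → mem s ≡ M →
      (∀ s′ → regs s′ inputReg ≡ n → regs s′ rowIndex ≡ i → regs s′ solvedFlag ≡ 0 →
         mem s′ ≡ M → (∀ k → k < n → LowVerdict s′ k) → Q s′) →
      wp (lowPass diagonal t u) Q s
    lowPass-rule {M} sound in≡n i≡ unsolved m≡ exit =
      fill-rule (lean false) in≡n λ s₁ in≡n₁ mem≡ i≡₁ flag≡ _ filled →
      for-rule columnIndex refl (lowStep diagonal t u) (LowInv M) step
        in≡n₁
        (trans i≡₁ i≡ , trans flag≡ unsolved , trans mem≡ m≡ , filled , λ _ ())
        (λ { s₂ in≡n₂ (i≡₂ , ≡0 , mem≡₂ , _ , low) → exit s₂ in≡n₂ i≡₂ ≡0 mem≡₂ low })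
      where
      step : ∀ k s → k < n → regs s columnIndex ≡ k → regs s inputReg ≡ n → LowInv M k s →
        wp (lowStep diagonal t u)
           (Next columnIndex (LowInv M) k) s
      step k s k<n k≡ in≡n (i≡ , ≡0 , mem≡ , filled , low) =
        ask-rule
          (wp (restore diagonal t u (lean false) ⨟ replies [ reg columnIndex ]≔ reg reply)
              (Next columnIndex (LowInv M) k))
          s (subst Sound (sym mem≡) sound) filled in≡n i≡ k≡ λ s′ asked →
        column-kept asked , input-kept asked , row-kept asked ,
        trans (flag-kept asked) ≡0 , trans (mem-kept asked) mem≡ , restorable asked ,
        all-below-suc
          (λ k′ k′<k → subst (Verdict Φ (Probe k′ (lean false)))
            (sym (trans
              (update-other (arrs s′ replies)
                (subst (_≢ k′) (sym (column-kept asked)) (≢-sym (<⇒≢ k′<k))))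
              (cong (λ f → f k′) (replies-kept asked))))
            (low k′ k′<k))
          (subst (Verdict Φ (Probe k (lean false)))
            (sym (trans (cong (update (regs s′ columnIndex) (regs s′ reply) (arrs s′ replies))
                          (sym (column-kept asked)))
                        (update-same (arrs s′ replies) (regs s′ columnIndex))))
            (probe-reply asked))

    -- A blocked clause weighs at least 9 under either leaning, so no reply is 0, and equal replies
    -- name one clause that is worst both times.
    repeated-reply : ∀ {k r r′} → (∀ c → Blocked (at k) t k u c) →
      Verdict Φ (Probe k (lean false)) r → Verdict Φ (Probe k (lean true)) r′ → r′ ≡ r →
      ∃ λ j → r′ ≡ suc (toℕ j) × Within (at k) (level t) k (level u) (Φ j)
    repeated-reply {k} blocked (satisfied all0) _ _ =
      contradiction (blocked-heavy (at k) t k u false (blocked false))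
        λ 9≤ → contradiction (subst (9 ≤_) (all0 _) 9≤) λ ()
    repeated-reply {k} blocked _ (satisfied all0) _ =
      contradiction (blocked-heavy (at k) t k u true (blocked true))
        λ 9≤ → contradiction (subst (9 ≤_) (all0 _) 9≤) λ ()
    repeated-reply {k} blocked (worst j _ max) (worst j′ _ max′) r≡
      with refl ← toℕ-injective (suc-injective r≡) =
      j , refl , agreement⇒within (at k) t k u blocked j λ
        { false → max ; true → max′ }

    -- `σ` satisfies some literal of the clause, and on the diagonal that can only be the probed
    -- one.
    forced : diagonal ≡ true → ∀ {k j} → Within (at k) (level t) k (level u) (Φ j) →
             ∀ {x} → k ≡ toℕ x → not t ≡ σ x
    forced refl {k} {j} within k≡x
      with ((c , holds)) ← All.lookupAny within (sat j) =
      case reduced c of λ { (i≡ , v≡) → trans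
        (cong not (sym (level-injective v≡))) (trans (not-involutive _)
          (trans (sym holds) (cong σ (toℕ-injective (trans i≡ k≡x))))) }
      where
      reduced : ∀ {ℓ} → Code ℓ k (level t) ⊎ Code ℓ k (level u) → Code ℓ k (level t)
      reduced (inj₁ c)         = c
      reduced (inj₂ (i≡ , v≡)) = i≡ , trans v≡ (cong level (sym (diagonal⇒t≡u refl)))

    assign-variable-rule : ∀ d t u {Q} s →
      (d ≡ true → Q (setArr outputs (regs s columnIndex) (level (not t)) s)) →
      (d ≡ false → Q s) → wp (assign-variable d t u) Q s
    assign-variable-rule true  t u s on off = on refl
    assign-variable-rule false t u s on off = off refl

    HighInv : Memory → ℕ → State n → Set
    HighInv M k s = regs s rowIndex ≡ i × regs s solvedFlag ≡ 0 ×
      Filled (lean true) s × (∀ k → k < n → LowVerdict s k) ×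
      Sound (mem s) × M ≼ mem s × (∀ k′ → k′ < k → Learned k′ (mem s))

    assigned-consistent : ∀ o {k} → (∀ {x} → k ≡ toℕ x → not t ≡ σ x) →
      (∀ (x : Fin n) → o (toℕ x) ≡ 2 ⊎ o (toℕ x) ≡ level (σ x)) →
      ∀ x → update k (level (not t)) o (toℕ x) ≡ 2 ⊎
            update k (level (not t)) o (toℕ x) ≡ level (σ x)
    assigned-consistent o {k} hit old x with update-cases o k {level (not t)} (toℕ x)
    ... | inj₁ (k≡x , eq) = inj₂ (trans eq (cong level (hit k≡x)))
    ... | inj₂ (_ , eq)   = Sum.map (trans eq) (trans eq) (old x)

    -- If the replies differ, no clause is the only one within the probe, for it would have been
    -- returned twice; so there is nothing to learn. If they agree, they name a clause within the
    -- probe, which is the unique one whenever a unique one exists.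
    highStep-rule : ∀ {M s₀} k s → k < n → Asked (lean true) k s₀ s →
      regs s solvedFlag ≡ 0 → (∀ k → k < n → LowVerdict s k) →
      (∀ c → Blocked (at k) t k u c) →
      Sound (mem s) × M ≼ mem s × (∀ k′ → k′ < k → Learned k′ (mem s)) →
      wp (restore diagonal t u (lean true) ⨟ compare-replies diagonal t u)
         (Next columnIndex (HighInv M) k) s
    highStep-rule {M} k s k<n asked ≡0 low blocked (sound , M≼ , learned)
      with refl ← column-kept asked =
      (λ ≢0 → refl , input-kept asked , row-kept asked , ≡0 , restorable asked , low ,
        sound , M≼ , all-below-suc learned λ j compatible within unique → contradiction
          (difference≡0 (trans (reply-is true j compatible within unique high)
                          (sym (reply-is false j compatible within unique (low k k<n)))))
          ≢0) ,
      λ ≡0′ → recording (repeated-reply blocked (low k k<n) high (difference≡0⇒ _ _ ≡0′))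
      where
      a r : ℕ
      a = regs s anchorIndex
      r = regs s reply

      high : Verdict Φ (Probe k (lean true)) r
      high = probe-reply asked

      reply-is : ∀ c j → (at k ≡ k → t ≡ u) → Within (at k) (level t) k (level u) (Φ j) →
        (∀ j′ → Within (at k) (level t) k (level u) (Φ j′) → j′ ≡ j) →
        ∀ {r} → Verdict Φ (Probe k (lean c)) r → r ≡ suc (toℕ j)
      reply-is c j compatible = unique⇒verdict (at k) t k u compatible c j

      recording : (∃ λ j → r ≡ suc (toℕ j) × Within (at k) (level t) k (level u) (Φ j)) →
        wp (record-clause diagonal t u)
          (Next columnIndex (HighInv M) k)
          (setArr numerators a (lean true) (setArr numerators k (lean true) s))
      recording (j , r≡ , within) = assign-variable-rule diagonal t u _
          (λ diagonal≡ → refl , input-kept asked , row-kept asked , ≡0 , restorable asked , low ,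
            record { denoms≡3   = denoms≡3 sound
                   ; consistent = assigned-consistent (arrs s outputs) (forced diagonal≡ within)
                                    (consistent sound) } ,
            ≼-trans M≼ grown′ ,
            all-below-suc (λ k′ k′<k → Learned-≼ grown′ (learned k′ k′<k))
              (λ j′ _ _ unique → entry j′ unique , λ _ → subst (_≢ 2)
                (sym (update-same (arrs s outputs) k)) (level≢2 (not t))))
          (λ diagonal≡ → refl , input-kept asked , row-kept asked , ≡0 , restorable asked , low ,
            record { denoms≡3 = denoms≡3 sound ; consistent = consistent sound } ,
            ≼-trans M≼ grown ,
            all-below-suc (λ k′ k′<k → Learned-≼ grown (learned k′ k′<k))
              (λ j′ _ _ unique → entry j′ unique ,
                 λ d → contradiction (trans (sym d) diagonal≡) λ ()))
        where
        M₁ : Memory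
        M₁ = write r a (level t) k (level u) (mem s)

        within′ : Within a (level t) k (level u) (Φ j)
        within′ = subst (λ a → Within a (level t) k (level u) (Φ j)) (sym (anchored asked)) within

        grown : mem s ≼ M₁
        grown = write-≼ (mem s) j r≡ within′

        grown′ : mem s ≼ assign k (level (not t)) M₁
        grown′ = ≼-trans grown (assign-≼ {k} M₁ (level≢2 (not t)))

        entry : ∀ j′ → (∀ j → Within (at k) (level t) k (level u) (Φ j) → j ≡ j′) → Entry M₁ j′
        entry j′ unique = subst (Entry M₁) (unique j within) (write-entry (mem s) j r≡ within′)

    highPass-rule : ∀ {M Q s} → (∀ c k → k < n → Blocked (at k) t k u c) →
      Sound M → regs s inputReg ≡ n → regs s rowIndex ≡ i →
      regs s solvedFlag ≡ 0 → mem s ≡ M → (∀ k → k < n → LowVerdict s k) →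
      (∀ s′ → regs s′ inputReg ≡ n → regs s′ rowIndex ≡ i → regs s′ solvedFlag ≡ 0 →
         Sound (mem s′) → M ≼ mem s′ → (∀ k → k < n → Learned k (mem s′)) → Q s′) →
      wp (highPass diagonal t u) Q s
    highPass-rule {M} blocked sound in≡n i≡ unsolved m≡ low exit =
      fill-rule (lean true) in≡n λ s₁ in≡n₁ mem≡ i≡₁ flag≡ replies≡ filled →
      for-rule columnIndex refl (highStep diagonal t u) (HighInv M) step in≡n₁
        (trans i≡₁ i≡ , trans flag≡ unsolved , filled ,
         (λ k k<n → subst (λ f → Verdict Φ (Probe k (lean false)) (f k)) (sym replies≡)
           (low k k<n)) ,
         subst Sound (sym (trans mem≡ m≡)) sound ,
         subst (M ≼_) (sym (trans mem≡ m≡)) ≼-refl , λ _ ())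
        (λ { s₂ in≡n₂ (i≡₂ , ≡0 , _ , _ , sound₂ , M≼ , learned) →
               exit s₂ in≡n₂ i≡₂ ≡0 sound₂ M≼ learned })
      where
      step : ∀ k s → k < n → regs s columnIndex ≡ k → regs s inputReg ≡ n → HighInv M k s →
        wp (highStep diagonal t u)
           (Next columnIndex (HighInv M) k) s
      step k s k<n k≡ in≡n (i≡ , ≡0 , filled , low , sound , M≼ , learned) =
        ask-rule (wp (restore diagonal t u (lean true) ⨟ compare-replies diagonal t u)
                     (Next columnIndex (HighInv M) k))
          s sound filled in≡n i≡ k≡ λ s′ asked →
        highStep-rule k s′ k<n asked (trans (flag-kept asked) ≡0)
          (λ k k<n → subst (λ f → Verdict Φ (Probe k (lean false)) (f k))
                       (sym (replies-kept asked)) (low k k<n))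
          (λ c → blocked c k k<n)
          (subst (λ M′ → Sound M′ × M ≼ M′ × (∀ k′ → k′ < k → Learned k′ M′))
            (sym (mem-kept asked)) (sound , M≼ , learned))

    row-rule : ∀ {M Q s} → Sound M → regs s inputReg ≡ n → regs s rowIndex ≡ i →
      regs s solvedFlag ≡ 0 → mem s ≡ M →
      (∀ s′ → regs s′ inputReg ≡ n → regs s′ rowIndex ≡ i →
         Outcome (λ s′ → Sound (mem s′) × M ≼ mem s′ × (∀ k → k < n → Learned k (mem s′))) s′ →
         Q s′) →
      wp (row diagonal t u) Q s
    row-rule sound in≡n i≡ unsolved m≡ exit =
      purePass-rule false sound in≡n i≡ unsolved m≡ λ s₁ in≡n₁ i≡₁ outcome₁ →
      outcome-cases {s = s₁} outcome₁
        (λ ≢0 solved → exit s₁ in≡n₁ i≡₁ (inj₁ (≢0 , solved)))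
        λ { ≡0₁ (m≡₁ , blocked₁) →
      purePass-rule true sound in≡n₁ i≡₁ ≡0₁ m≡₁ λ s₂ in≡n₂ i≡₂ outcome₂ →
      outcome-cases {s = s₂} outcome₂
        (λ ≢0 solved → exit s₂ in≡n₂ i≡₂ (inj₁ (≢0 , solved)))
        λ { ≡0₂ (m≡₂ , blocked₂) →
      lowPass-rule sound in≡n₂ i≡₂ ≡0₂ m≡₂ λ s₃ in≡n₃ i≡₃ ≡0₃ m≡₃ low →
      highPass-rule (λ { false → blocked₁ ; true → blocked₂ })
        sound in≡n₃ i≡₃ ≡0₃ m≡₃ low λ s₄ in≡n₄ i≡₄ ≡0₄ sound₄ M≼ learned →
      exit s₄ in≡n₄ i≡₄ (inj₂ (≡0₄ , sound₄ , M≼ , learned)) } }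

  -- On the diagonal `at k` computes to `k`, so the row number 0 is a placeholder.
  Diagonal : Bool → Memory → Set
  Diagonal t M = ∀ k → k < n → Row.Learned true t t (λ _ → refl) 0 k M

  Pairs : ℕ → Bool × Bool → Memory → Set
  Pairs i (t , u) M = ∀ k → k < n → Row.Learned false t u (λ ()) i k M

  Diagonal-≼ : ∀ {t M M′} → M ≼ M′ → Diagonal t M → Diagonal t M′
  Diagonal-≼ {t} M≼ learned k k<n =
    Row.Learned-≼ true t t (λ _ → refl) 0 M≼ (learned k k<n)

  Pairs-≼ : ∀ {i tu M M′} → M ≼ M′ → Pairs i tu M → Pairs i tu M′
  Pairs-≼ {i} {t , u} M≼ learned k k<n = Row.Learned-≼ false t u (λ ()) i M≼ (learned k k<n)

  rows-solved : ∀ l {Q s} → regs s solvedFlag ≢ 0 → Q s → wp (rows l) Q s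
  rows-solved []      ≢0 q = q
  rows-solved (_ ∷ l) ≢0 q = (λ _ → rows-solved l ≢0 q) , λ ≡0 → contradiction ≡0 ≢0

  rows-rule : ∀ l {i Q} s → regs s inputReg ≡ n → regs s rowIndex ≡ i →
    regs s solvedFlag ≡ 0 → Sound (mem s) →
    (∀ s′ → regs s′ inputReg ≡ n → regs s′ rowIndex ≡ i →
       Outcome (λ s′ → Sound (mem s′) × mem s ≼ mem s′ × All (λ tu → Pairs i tu (mem s′)) l) s′ →
       Q s′) →
    wp (rows l) Q s
  rows-rule [] s in≡n i≡ ≡0 sound exit = exit s in≡n i≡ (inj₂ (≡0 , sound , ≼-refl , []))
  rows-rule ((t , u) ∷ l) {i} {Q} s in≡n i≡ ≡0 sound exit =
    (λ ≢0 → contradiction ≡0 ≢0) , λ _ →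
    Row.row-rule false t u (λ ()) i sound in≡n i≡ ≡0 refl continue
    where
    continue : ∀ s₁ → regs s₁ inputReg ≡ n → regs s₁ rowIndex ≡ i →
      Outcome (λ s₁ → Sound (mem s₁) × mem s ≼ mem s₁ × Pairs i (t , u) (mem s₁)) s₁ →
      wp (rows l) Q s₁
    continue s₁ in≡n₁ i≡₁ (inj₁ (≢0 , solved)) =
      rows-solved l ≢0 (exit s₁ in≡n₁ i≡₁ (inj₁ (≢0 , solved)))
    continue s₁ in≡n₁ i≡₁ (inj₂ (≡0₁ , sound₁ , grown , learned)) =
      rows-rule l s₁ in≡n₁ i≡₁ ≡0₁ sound₁ λ s₂ in≡n₂ i≡₂ outcome →
      exit s₂ in≡n₂ i≡₂ (Sum.map₂
        (λ { (≡0₂ , sound₂ , grown₂ , rest) →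
          ≡0₂ , sound₂ , ≼-trans grown grown₂ , Pairs-≼ grown₂ learned ∷ rest }) outcome)

  Identified : ℕ → Memory → Set
  Identified i M = Sound M × (∀ t → Diagonal t M) ×
                   (∀ i′ → i′ < i → All (λ tu → Pairs i′ tu M) signs)

  identify-rule : ∀ {Q} s → regs s inputReg ≡ n → regs s solvedFlag ≡ 0 →
    (∀ s′ → regs s′ inputReg ≡ n → Outcome (λ s′ → Identified n (mem s′)) s′ → Q s′) →
    wp identify Q s
  identify-rule {Q} s in≡n unsolved exit =
    for-rule scanIndex refl
      (denominators-1 [ reg scanIndex ]≔ const 3 ⨟ outputs [ reg scanIndex ]≔ const 2)
      (λ k s → regs s solvedFlag ≡ 0 × (∀ x → x < k → denoms (mem s) x ≡ 3) ×
               (∀ x → x < k → assigned (mem s) x ≡ 2))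
      (λ { k s k<n refl in≡n (≡0 , d≡ , o≡) → refl , in≡n , ≡0 ,
           all-below-suc
             (λ x x<k → update-preserves (_≡ 3) (arrs s denominators-1) k x refl (d≡ x x<k))
             (update-same (arrs s denominators-1) k) ,
           all-below-suc
             (λ x x<k → update-preserves (_≡ 2) (arrs s outputs) k x refl (o≡ x x<k))
             (update-same (arrs s outputs) k) })
      in≡n (unsolved , (λ _ ()) , λ _ ())
      λ { s₁ in≡n₁ (≡0₁ , d≡ , o≡) →
    Row.row-rule true false false (λ _ → refl) (regs s₁ rowIndex)
      (record { denoms≡3 = λ x → d≡ (toℕ x) (toℕ<n x)
              ; consistent = λ x → inj₁ (o≡ (toℕ x) (toℕ<n x)) })
      in≡n₁ refl ≡0₁ refl λ s₂ in≡n₂ i≡₂ outcome₂ →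
    outcome-cases {s = s₂} outcome₂
      (λ ≢0 solved → pairs s₂ in≡n₂ (inj₁ (≢0 , solved)))
      λ { ≡0₂ (sound₂ , _ , learned₂) →
    Row.row-rule true true true (λ _ → refl) (regs s₁ rowIndex)
      sound₂ in≡n₂ i≡₂ ≡0₂ refl λ s₃ in≡n₃ i≡₃ outcome₃ →
    pairs s₃ in≡n₃ (Sum.map₂ (λ { (≡0₃ , sound₃ , grown , learned₃) → ≡0₃ , sound₃ ,
      (λ { false → Diagonal-≼ grown learned₂ ; true → learned₃ }) , λ _ () }) outcome₃) } }
    where
    I : ℕ → State n → Set
    I i = Outcome (λ s → Identified i (mem s))

    step : ∀ i s → i < n → regs s rowIndex ≡ i → regs s inputReg ≡ n → I i s →
      wp (rows signs) (Next rowIndex I i) s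
    step i s i<n i≡ in≡n (inj₁ (≢0 , solved)) =
      rows-solved signs ≢0 (i≡ , in≡n , inj₁ (≢0 , solved))
    step i s i<n i≡ in≡n (inj₂ (≡0 , sound , units , pairs)) =
      rows-rule signs s in≡n i≡ ≡0 sound λ s′ in≡n′ i≡′ outcome →
      i≡′ , in≡n′ , Sum.map₂ (λ { (≡0′ , sound′ , grown , new) → ≡0′ , sound′ ,
        (λ t → Diagonal-≼ grown (units t)) ,
        all-below-suc (λ i′ i′<i → All.map (λ {tu} → Pairs-≼ {tu = tu} grown) (pairs i′ i′<i))
          new }) outcome

    pairs : ∀ s → regs s inputReg ≡ n → I 0 s → wp (for rowIndex (rows signs)) Q s
    pairs s in≡n i = for-rule rowIndex refl (rows signs) I step in≡n i exit

  -- Pairs containing a unit literal are left out: the values given to the unit literals already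
  -- satisfy them.
  record Knowledge (M : Memory) : Set where
    field
      sound-memory : Sound M
      units : ∀ ℓ → Unit ℓ → assigned M (toℕ (var ℓ)) ≡ level (positive ℓ)
      pairs : ∀ {j ℓ ℓ′} → literals (Φ j) ≡ ℓ ∷ ℓ′ ∷ [] → ¬ Unit ℓ → ¬ Unit ℓ′ → Entry M j

  knowledge : RepetitionFree Φ → ∀ {M} → Identified n M → Knowledge M
  knowledge rf {M} (sound , diagonal , pairs) = record
    { sound-memory = sound
    ; units = unit-assigned
    ; pairs = λ {j} {ℓ} {ℓ′} eq ¬unit ¬unit′ → proj₁
        (pair-learned (not (positive ℓ)) (not (positive ℓ′)) (toℕ (var ℓ)) (toℕ<n (var ℓ))
          (toℕ (var ℓ′)) (toℕ<n (var ℓ′)) j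
          (λ same → contradiction (toℕ-injective same) (distinct eq))
          (subst (All _) (sym eq) (inj₁ (refl , refl) ∷ inj₂ (refl , refl) ∷ []))
          (pair-unique rf (σ , sat) eq ¬unit ¬unit′)) }
    where
    unit-assigned : ∀ ℓ → Unit ℓ → assigned M (toℕ (var ℓ)) ≡ level (positive ℓ)
    unit-assigned ℓ (j , eq) with consistent sound (var ℓ)
    -- The diagonal column of `ℓ` has assigned its variable. By soundness the value is then that of
    -- `σ`, which satisfies the unit clause.
    ... | inj₁ ≡2 = contradiction ≡2 (proj₂ (diagonal (not (positive ℓ))
            (toℕ (var ℓ)) (toℕ<n (var ℓ)) j (λ _ → refl)
            (subst (All _) (sym eq) (inj₁ (refl , refl) ∷ []))
            (unit-unique rf (σ , sat) eq)) refl)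
    ... | inj₂ ≡σ with subst (Any _) eq (sat j)
    ...   | here holds = trans ≡σ (cong level holds)

    pair-learned : ∀ t u i → i < n → Pairs i (t , u) M
    pair-learned t u i i<n with pairs i i<n
    pair-learned false false i i<n | p ∷ _             = p
    pair-learned false true  i i<n | _ ∷ p ∷ _         = p
    pair-learned true  false i i<n | _ ∷ _ ∷ p ∷ _     = p
    pair-learned true  true  i i<n | _ ∷ _ ∷ _ ∷ p ∷ _ = p

-- Limited backtracking

status : Reg
status = 7

-- Status 0 means running, 1 closed under propagation, 2 contradictory.
var₁ᵉ fal₁ᵉ var₂ᵉ fal₂ᵉ : Expr
var₁ᵉ = variable₁ [ reg reply ]
fal₁ᵉ = falsifier₁ [ reg reply ]
var₂ᵉ = variable₂ [ reg reply ]
fal₂ᵉ = falsifier₂ [ reg reply ]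

-- The cases ask which literals of the returned clause are false. One false literal forces the
-- other, two are a contradiction, and none means that even the worst clause has both variables
-- open. The value satisfying a literal is 4 minus the one falsifying it.
resolve : Prog
resolve =
  if≢0 difference (numerators [ var₁ᵉ ]) fal₁ᵉ then
    (if≢0 difference (numerators [ var₂ᵉ ]) fal₂ᵉ
      then (status ≔ const 1)
      else (numerators [ var₁ᵉ ]≔ const 4 ⊖ fal₁ᵉ))
  else
    (if≢0 difference (numerators [ var₂ᵉ ]) fal₂ᵉ
      then (numerators [ var₂ᵉ ]≔ const 4 ⊖ fal₂ᵉ)
      else (status ≔ const 2))

decide : Prog
decide = if≢0 reg reply then resolve else (status ≔ const 1)

-- Once the status is nonzero the remaining rounds idle, so that a counted loop suffices.
propagate : Prog
propagate = if≢0 reg status then skip else (query reply ⨟ decide)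

load save : Prog
load = for scanIndex (numerators [ reg scanIndex ]≔ outputs [ reg scanIndex ])
save = for scanIndex (outputs [ reg scanIndex ]≔ numerators [ reg scanIndex ])

-- Only status 2 survives the subtraction. A contradiction discards the propagated values and makes
-- the tried variable true; otherwise all of them are saved.
settle : Prog
settle = if≢0 reg status ⊖ const 1 then (outputs [ reg rowIndex ]≔ const 4) else save

attempt : Prog
attempt = load ⨟ numerators [ reg rowIndex ]≔ const 0 ⨟ status ≔ const 0 ⨟
          for columnIndex propagate ⨟ settle

extendStep : Prog
extendStep = if≢0 difference (outputs [ reg rowIndex ]) (const 2) then skip else attempt

extend : Prog
extend = for rowIndex extendStep

algorithm₂SAT : Prog
algorithm₂SAT = identify ⨟ if≢0 reg solvedFlag then save else extend

count : (ℕ → ℕ) → ℕ → ℕ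
count f zero    = 0
count f (suc k) = (if f k ≡ᵇ 2 then 0 else 1) + count f k

count≤ : ∀ f k → count f k ≤ k
count≤ f zero    = z≤n
count≤ f (suc k) with f k ≡ᵇ 2
... | true  = m≤n⇒m≤1+n (count≤ f k)
... | false = s≤s (count≤ f k)

≢2⇒≡ᵇ : ∀ {y} → y ≢ 2 → (y ≡ᵇ 2) ≡ false
≢2⇒≡ᵇ {0} _ = refl
≢2⇒≡ᵇ {1} _ = refl
≢2⇒≡ᵇ {2} ≢2 = contradiction refl ≢2
≢2⇒≡ᵇ {suc (suc (suc _))} _ = refl

count-update-above : ∀ f {x v} k → k ≤ x → count (update x v f) k ≡ count f k
count-update-above f zero    _   = refl
count-update-above f {x} {v} (suc k) k<x = cong₂ (λ y c → (if y ≡ᵇ 2 then 0 else 1) + c)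
  (update-other f (≢-sym (<⇒≢ k<x))) (count-update-above f k (<⇒≤ k<x))

count-update : ∀ f {x v} k → x < k → f x ≡ 2 → v ≢ 2 →
               count (update x v f) k ≡ suc (count f k)
count-update f {x} {v} (suc k) x<1+k fx≡2 v≢2 with m<1+n⇒m<n∨m≡n x<1+k
... | inj₁ x<k  = trans (cong₂ (λ y c → (if y ≡ᵇ 2 then 0 else 1) + c)
        (update-other f (<⇒≢ x<k)) (count-update f k x<k fx≡2 v≢2))
        (+-suc (if f k ≡ᵇ 2 then 0 else 1) (count f k))
... | inj₂ refl rewrite update-same f k {v} | ≢2⇒≡ᵇ v≢2 | fx≡2 =
        cong suc (count-update-above f k ≤-refl)

0<count : ∀ f {x} k → x < k → f x ≢ 2 → 0 < count f k
0<count f (suc k) x<1+k fx≢2 with m<1+n⇒m<n∨m≡n x<1+k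
... | inj₁ x<k  = ≤-trans (0<count f k x<k fx≢2) (m≤n+m (count f k) _)
... | inj₂ refl rewrite ≢2⇒≡ᵇ fx≢2 = s≤s z≤n

not-≡ᵇ-level : ∀ b → not (level b ≡ᵇ 0) ≡ b
not-≡ᵇ-level false = refl
not-≡ᵇ-level true  = refl

4∸level-not : ∀ u → 4 ∸ level (not u) ≡ level u
4∸level-not false = refl
4∸level-not true  = refl

-- Closed partial assignments and unit propagation

module Extension {n m} {Φ : Formula n m} (is2 : Is2SAT Φ) where

  open Identification Φ is2

  -- The numerator 2 marks an unassigned variable.
  Partial : (ℕ → ℕ) → Set
  Partial f = ∀ (x : Fin n) → f (toℕ x) ≡ 2 ⊎ (∃ λ b → f (toℕ x) ≡ level b)

  Extends : (Fin n → Bool) → (ℕ → ℕ) → Set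
  Extends σ f = ∀ x → f (toℕ x) ≡ 2 ⊎ f (toℕ x) ≡ level (σ x)

  UnitsHold : (ℕ → ℕ) → Set
  UnitsHold f = ∀ ℓ → Unit ℓ → f (toℕ (var ℓ)) ≡ level (positive ℓ)

  -- The threshold 4 is `2 * 2`, the weight of a clause with two unassigned literals; a false and an
  -- unassigned literal together weigh 8.
  Closed : (ℕ → ℕ) → Set
  Closed f = ∀ j → weight f (Φ j) ≤ 4

  holding-falsity : ∀ {f} (ℓ : Literal n) → f (toℕ (var ℓ)) ≡ level (positive ℓ) → litFalsity f ℓ ≡ 0
  holding-falsity ℓ f≡ = trans (cong (falsity (positive ℓ)) f≡) (falsity-level (positive ℓ))

  -- A true literal annihilates the weight. Hence, once the units hold, a clause of positive weight
  -- is free of unit literals and can be looked up in the table.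
  violated-pair : Satisfiable Φ → ∀ {f j} → UnitsHold f → 0 < weight f (Φ j) →
    ∃₂ λ ℓ ℓ′ → literals (Φ j) ≡ ℓ ∷ ℓ′ ∷ [] × ¬ Unit ℓ × ¬ Unit ℓ′
  violated-pair satisfiable {f} {j} units >0 with shape satisfiable j
  ... | unit ℓ eq = contradiction
          (trans (cong (listWeight f) eq) (cong (_* 4) (holding-falsity {f} ℓ (units ℓ (j , eq)))))
          (m<n⇒n≢0 >0)
  ... | pair ℓ ℓ′ eq = ℓ , ℓ′ , eq ,
          (λ u → contradiction (trans (cong (listWeight f) eq)
            (cong (_* litFalsity f ℓ′) (holding-falsity {f} ℓ (units ℓ u)))) (m<n⇒n≢0 >0)) ,
          (λ u → contradiction (trans (cong (listWeight f) eq)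
            (trans (cong (litFalsity f ℓ *_) (holding-falsity {f} ℓ′ (units ℓ′ u)))
                   (*-zeroʳ (litFalsity f ℓ)))) (m<n⇒n≢0 >0))

  unfalsified-half : ∀ {f i v} {ℓ : Literal n} → Partial f → Code ℓ i v → 0 < litFalsity f ℓ → f i ≢ v → f i ≡ 2
  unfalsified-half {f} {ℓ = ℓ} partial (refl , refl) >0 ≢v with partial (var ℓ)
  ... | inj₁ ≡2       = ≡2
  ... | inj₂ (b , ≡b) = contradiction
          (trans ≡b (sym (0<falsity-level⇒ (positive ℓ) b
            (subst (λ y → 0 < falsity (positive ℓ) y) ≡b >0)))) ≢v

  refuted : ∀ {σ f i v} {ℓ : Literal n} → Extends σ f → Code ℓ i v → f i ≡ v → σ (var ℓ) ≢ positive ℓ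
  refuted {ℓ = ℓ} extends (refl , refl) f≡v σ≡ with extends (var ℓ)
  ... | inj₁ ≡2 = contradiction (trans (sym f≡v) ≡2) (level≢2 (not (positive ℓ)))
  ... | inj₂ ≡σ = contradiction
          (trans (level-injective (trans (sym f≡v) ≡σ)) σ≡) (not-¬ refl ∘ sym)

  product-positive : ∀ a b → 0 < a * b → 0 < a × 0 < b
  product-positive (suc a) (suc b) _  = s≤s z≤n , s≤s z≤n
  product-positive (suc a) zero    >0 = contradiction (*-zeroʳ a) (m<n⇒n≢0 >0)

  half-or-false : ∀ f (ℓ : Literal n) → Partial f → 0 < litFalsity f ℓ →
                  f (toℕ (var ℓ)) ≡ 2 ⊎ litFalsity f ℓ ≡ 4
  half-or-false f ℓ partial >0 with partial (var ℓ)
  ... | inj₁ ≡2       = inj₁ ≡2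
  ... | inj₂ (b , ≡b) = inj₂ (trans (cong (falsity (positive ℓ)) (trans ≡b
          (sym (0<falsity-level⇒ (positive ℓ) b
            (subst (λ y → 0 < falsity (positive ℓ) y) ≡b >0)))))
          (falsity-level-not (positive ℓ)))

  -- Positive falsities are 2 or 4, and only the product `2 * 2` is at most 4.
  both-half : ∀ f (ℓ ℓ′ : Literal n) → Partial f → 0 < litFalsity f ℓ * litFalsity f ℓ′ →
    litFalsity f ℓ * litFalsity f ℓ′ ≤ 4 → f (toℕ (var ℓ)) ≡ 2 × f (toℕ (var ℓ′)) ≡ 2
  both-half f ℓ ℓ′ partial >0 ≤4
    with product-positive (litFalsity f ℓ) (litFalsity f ℓ′) >0
  ... | >0₁ , >0₂ with half-or-false f ℓ partial >0₁ | half-or-false f ℓ′ partial >0₂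
  ... | inj₁ ≡2 | inj₁ ≡2′ = ≡2 , ≡2′
  ... | inj₁ ≡2 | inj₂ ≡4 rewrite ≡2 | ≡4 | falsity-2 (positive ℓ) =
          contradiction ≤4 λ { (s≤s (s≤s (s≤s (s≤s ())))) }
  ... | inj₂ ≡4 | inj₁ ≡2 rewrite ≡2 | ≡4 | falsity-2 (positive ℓ′) =
          contradiction ≤4 λ { (s≤s (s≤s (s≤s (s≤s ())))) }
  ... | inj₂ ≡4 | inj₂ ≡4′ rewrite ≡4 | ≡4′ =
          contradiction ≤4 λ { (s≤s (s≤s (s≤s (s≤s ())))) }

  complete : (ℕ → ℕ) → (Fin n → Bool) → Fin n → Bool
  complete f σ x = if f (toℕ x) ≡ᵇ 2 then σ x else not (f (toℕ x) ≡ᵇ 0)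

  complete-extends : ∀ {f σ} → Partial f → Extends (complete f σ) f
  complete-extends {f} {σ} partial x with partial x
  ... | inj₁ ≡2 = inj₁ ≡2
  ... | inj₂ (false , ≡b) rewrite ≡b = inj₂ refl
  ... | inj₂ (true  , ≡b) rewrite ≡b = inj₂ refl

  -- Clauses not yet satisfied by a closed assignment have both literals unassigned.
  complete-satisfies : ∀ {f σ} → Partial f → UnitsHold f → Closed f → Satisfies σ Φ →
                       Satisfies (complete f σ) Φ
  complete-satisfies {f} {σ} partial units closed sat j
    with weight f (Φ j) in w≡
  ... | zero = Any.map (λ {ℓ} → holds ℓ) (weight≡0⇒ f {literals (Φ j)} w≡)
    where
    holds : ∀ ℓ → litFalsity f ℓ ≡ 0 → complete f σ (var ℓ) ≡ positive ℓ
    holds ℓ ≡0 with f (toℕ (var ℓ)) ≟ 2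
    ... | yes ≡2 = contradiction
            (trans (sym (falsity-2 (positive ℓ)))
                   (trans (cong (falsity (positive ℓ)) (sym ≡2)) ≡0)) λ ()
    ... | no ≢2 rewrite ≢2⇒≡ᵇ ≢2 = falsity≡0⇒ (positive ℓ) _ ≡0
  ... | suc w with violated-pair (σ , sat) {f} {j} units (subst (0 <_) (sym w≡) (s≤s z≤n))
  ... | ℓ , ℓ′ , eq , _ with both-half f ℓ ℓ′ partial
          (subst (0 <_) (trans (sym w≡) (cong (listWeight f) eq)) (s≤s z≤n))
          (subst (_≤ 4) (cong (listWeight f) eq) (closed j))
  ... | ≡2 , ≡2′ = subst (Any _) (sym eq) (case subst (Any _) eq (sat j) of λ
          { (here holds)         → here (trans (kept ≡2) holds)
          ; (there (here holds)) → there (here (trans (kept ≡2′) holds)) })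
    where
    kept : ∀ {x} → f (toℕ x) ≡ 2 → complete f σ x ≡ σ x
    kept ≡2 rewrite ≡2 = refl

  module Attempt (σ : Fin n → Bool) (sat : Satisfies σ Φ) (x₀ : Fin n) where

    -- The field `extended` is conditional because the trial makes `x₀` false: the propagated values
    -- are consequences of that choice.
    record Trial (b : ℕ) (f : ℕ → ℕ) : Set where
      field
        partial   : Partial f
        units     : UnitsHold f
        extended  : σ x₀ ≡ false → Extends σ f
        set-below : ∀ x → x < b → f x ≢ 2

    open Trial

    set-literal : ∀ {b f i v} {ℓ : Literal n} → Trial b f → Code ℓ i v → f i ≡ 2 →
      (σ x₀ ≡ false → σ (var ℓ) ≡ positive ℓ) → Trial b (update i (4 ∸ v) f)
    set-literal {b} {f} {ℓ = ℓ} trial (refl , refl) ≡2 implied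
      rewrite 4∸level-not (positive ℓ) = record
      { partial   = λ x → update-preserves (λ y → y ≡ 2 ⊎ ∃ λ b → y ≡ level b) f i (toℕ x)
                            (inj₂ (positive ℓ , refl)) (partial trial x)
      ; units     = units′
      ; extended  = extended′
      ; set-below = λ x x<b → update-preserves (_≢ 2) f i x (level≢2 (positive ℓ))
                                (set-below trial x x<b)
      }
      where
      i = toℕ (var ℓ)

      units′ : UnitsHold (update i (level (positive ℓ)) f)
      units′ ℓ′ u with update-cases f i {level (positive ℓ)} (toℕ (var ℓ′))
      -- A variable of a unit clause is already assigned, whereas the variable being set was open.
      ... | inj₁ (i≡ , _) = contradiction
              (trans (sym (units trial ℓ′ u)) (trans (cong f (sym i≡)) ≡2))
              (level≢2 (positive ℓ′))
      ... | inj₂ (_ , eq) = trans eq (units trial ℓ′ u)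

      extended′ : σ x₀ ≡ false → Extends σ (update i (level (positive ℓ)) f)
      extended′ σ≡ x with update-cases f i {level (positive ℓ)} (toℕ x)
      ... | inj₁ (i≡ , eq) = inj₂ (trans eq (cong level
              (trans (sym (implied σ≡)) (cong σ (toℕ-injective i≡)))))
      ... | inj₂ (_ , eq)  = Sum.map (trans eq) (trans eq) (extended trial σ≡ x)

    -- A step that does not halt assigns a new variable, so n steps are enough.
    data Progress (k : ℕ) (f : ℕ → ℕ) : ℕ → Set where
      running       : k < count f n → Progress k f 0
      closed        : Closed f → Progress k f 1
      contradictory : σ x₀ ≡ true → Progress k f 2

    set-progress : ∀ {k f i v} {ℓ : Literal n} → Code ℓ i v → f i ≡ 2 → k < count f n →
                   Progress (suc k) (update i (4 ∸ v) f) 0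
    set-progress {k} {f} {ℓ = ℓ} (refl , refl) ≡2 k< = running (subst (suc k <_)
      (sym (count-update f n (toℕ<n (var ℓ)) ≡2 (4∸≢2 (positive ℓ)))) (s≤s k<))
      where
      4∸≢2 : ∀ u → 4 ∸ level (not u) ≢ 2
      4∸≢2 false ()
      4∸≢2 true  ()

    -- Were `σ x₀` false, `σ` would extend `f` and falsify both literals of a clause that it
    -- satisfies.
    conflict : ∀ {b f j i v k w} → Trial b f → Spelled j i v k w → f i ≡ v → f k ≡ w → σ x₀ ≡ true
    conflict trial spelled f≡v f≡w with σ x₀ in σ≡
    ... | true  = refl
    ... | false with Spelled.one-holds spelled σ sat
    ... | inj₁ holds = contradiction holds
            (refuted (extended trial σ≡) (Spelled.first-code spelled) f≡v)
    ... | inj₂ holds = contradiction holds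
            (refuted (extended trial σ≡) (Spelled.second-code spelled) f≡w)

    first-implied : ∀ {b f j i v k w} → Trial b f → (sp : Spelled j i v k w) → f k ≡ w →
      σ x₀ ≡ false → σ (var (Spelled.first sp)) ≡ positive (Spelled.first sp)
    first-implied trial spelled f≡w σ≡ with Spelled.one-holds spelled σ sat
    ... | inj₁ holds = holds
    ... | inj₂ holds = contradiction holds
            (refuted (extended trial σ≡) (Spelled.second-code spelled) f≡w)

    second-implied : ∀ {b f j i v k w} → Trial b f → (sp : Spelled j i v k w) → f i ≡ v →
      σ x₀ ≡ false → σ (var (Spelled.second sp)) ≡ positive (Spelled.second sp)
    second-implied trial spelled f≡v σ≡ with Spelled.one-holds spelled σ sat
    ... | inj₁ holds = contradiction holds
            (refuted (extended trial σ≡) (Spelled.first-code spelled) f≡v)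
    ... | inj₂ holds = holds

    halves : ∀ {b f j i v k w} → Trial b f → Spelled j i v k w → 0 < weight f (Φ j) →
      (f i ≢ v → f i ≡ 2) × (f k ≢ w → f k ≡ 2)
    halves {f = f} trial spelled >0
      with product-positive _ _ (subst (0 <_) (Spelled.weight-product spelled f) >0)
    ... | >0₁ , >0₂ = unfalsified-half (partial trial) (Spelled.first-code spelled) >0₁ ,
                      unfalsified-half (partial trial) (Spelled.second-code spelled) >0₂

    -- The returned clause weighs `2 * 2` and, being worst, bounds all the others.
    halves-close : ∀ {f j i v k w} → Spelled j i v k w → f i ≡ 2 → f k ≡ 2 →
      (∀ l → weight f (Φ l) ≤ weight f (Φ j)) → Closed f
    halves-close {f} spelled fi≡2 fk≡2 max l = ≤-trans (max l) (≤-reflexive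
      (trans (Spelled.weight-product spelled f)
        (cong₂ _*_ (falsity-half (Spelled.first-code spelled) fi≡2)
                   (falsity-half (Spelled.second-code spelled) fk≡2))))
      where
      falsity-half : ∀ {i v} {ℓ : Literal n} → Code ℓ i v → f i ≡ 2 → litFalsity f ℓ ≡ 2
      falsity-half {ℓ = ℓ} (refl , _) ≡2 =
        trans (cong (falsity (positive ℓ)) ≡2) (falsity-2 (positive ℓ))

    Trial-cong : ∀ {b f g} → b ≤ n → (∀ x → x < n → f x ≡ g x) → Trial b f → Trial b g
    Trial-cong b≤n f≗g trial = record
      { partial   = λ x → subst (λ y → y ≡ 2 ⊎ ∃ λ b → y ≡ level b) (at x) (partial trial x)
      ; units     = λ ℓ u → trans (sym (at (var ℓ))) (units trial ℓ u)
      ; extended  = λ σ≡ x → subst (λ y → y ≡ 2 ⊎ y ≡ level (σ x)) (at x) (extended trial σ≡ x)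
      ; set-below = λ x x<b → subst (_≢ 2) (f≗g x (<-≤-trans x<b b≤n)) (set-below trial x x<b)
      }
      where at = λ (x : Fin n) → f≗g (toℕ x) (toℕ<n x)

verdict-worst : ∀ {n m} {Φ : Formula n m} {f r} → Verdict Φ f r → r ≢ 0 →
  ∃ λ j → r ≡ suc (toℕ j) × 0 < weight f (Φ j) × (∀ k → weight f (Φ k) ≤ weight f (Φ j))
verdict-worst (satisfied _)     ≢0 = contradiction refl ≢0
verdict-worst (worst j >0 max)  _  = j , refl , >0 , max

-- Correctness of the complete run

module Run {n m} {Φ : Formula n m} (is2 : Is2SAT Φ) (O : Oracle Φ) where

  open Hoare O
  open Identification Φ is2
  open Extension {Φ = Φ} is2

  Table : (Arr → ℕ → ℕ) → Set
  Table A = (∀ (x : Fin n) → A denominators-1 (toℕ x) ≡ 3) ×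
    (∀ j ℓ ℓ′ → literals (Φ j) ≡ ℓ ∷ ℓ′ ∷ [] → ¬ Unit ℓ → ¬ Unit ℓ′ →
       let r = suc (toℕ j) in
       Within (A variable₁ r) (A falsifier₁ r) (A variable₂ r) (A falsifier₂ r) (Φ j))

  load-rule : ∀ {Q} s → regs s inputReg ≡ n → Table (arrs s) →
    (∀ s′ → regs s′ inputReg ≡ n → regs s′ rowIndex ≡ regs s rowIndex → Table (arrs s′) →
       arrs s′ outputs ≡ arrs s outputs →
       (∀ x → x < n → arrs s′ numerators x ≡ arrs s outputs x) → Q s′) →
    wp load Q s
  load-rule s in≡n table exit =
    for-rule scanIndex refl (numerators [ reg scanIndex ]≔ outputs [ reg scanIndex ])
      (λ k s′ → regs s′ rowIndex ≡ regs s rowIndex × Table (arrs s′) ×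
         arrs s′ outputs ≡ arrs s outputs ×
         (∀ x → x < k → arrs s′ numerators x ≡ arrs s outputs x))
      (λ { k s′ k<n refl in≡n′ (row≡ , table′ , out≡ , copied) →
        refl , in≡n′ , row≡ , table′ , out≡ ,
        all-below-suc
          (λ x x<k → trans (update-other (arrs s′ numerators) (≢-sym (<⇒≢ x<k))) (copied x x<k))
          (trans (update-same (arrs s′ numerators) k) (cong (λ f → f k) out≡)) })
      in≡n (refl , table , refl , λ _ ())
      (λ { s′ in≡n′ (row≡ , table′ , out≡ , copied) → exit s′ in≡n′ row≡ table′ out≡ copied })

  save-rule : ∀ {Q} s → regs s inputReg ≡ n →
    (∀ s′ → regs s′ inputReg ≡ n → regs s′ rowIndex ≡ regs s rowIndex →
       (Table (arrs s) → Table (arrs s′)) →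
       (∀ x → x < n → arrs s numerators x ≡ arrs s′ outputs x) → Q s′) →
    wp save Q s
  save-rule s in≡n exit =
    for-rule scanIndex refl (outputs [ reg scanIndex ]≔ numerators [ reg scanIndex ])
      (λ k s′ → regs s′ rowIndex ≡ regs s rowIndex × (Table (arrs s) → Table (arrs s′)) ×
         arrs s′ numerators ≡ arrs s numerators ×
         (∀ x → x < k → arrs s numerators x ≡ arrs s′ outputs x))
      (λ { k s′ k<n refl in≡n′ (row≡ , table , num≡ , copied) →
        refl , in≡n′ , row≡ , table , num≡ ,
        all-below-suc
          (λ x x<k → trans (copied x x<k)
             (sym (update-other (arrs s′ outputs) (≢-sym (<⇒≢ x<k)))))
          (trans (cong (λ f → f k) (sym num≡)) (sym (update-same (arrs s′ outputs) k))) })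
      in≡n (refl , id , refl , λ _ ())
      (λ { s′ in≡n′ (row≡ , table , _ , copied) → exit s′ in≡n′ row≡ table copied })

  module _ (σ : Fin n → Bool) (sat : Satisfies σ Φ) (x₀ : Fin n) (B : ℕ → ℕ) where

    open Attempt σ sat x₀
    open Trial

    -- `B` is the content of `outputs` before the trial. It stays untouched, so that a contradiction
    -- is undone by discarding the numerators.
    TrialInv : ℕ → State n → Set
    TrialInv k s = regs s rowIndex ≡ toℕ x₀ × arrs s outputs ≡ B × Table (arrs s) ×
      Trial (suc (toℕ x₀)) (arrs s numerators) × Progress k (arrs s numerators) (regs s status)

    decide-rule : ∀ {k} s → regs s columnIndex ≡ k → regs s inputReg ≡ n →
      regs s rowIndex ≡ toℕ x₀ → arrs s outputs ≡ B → Table (arrs s) →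
      Trial (suc (toℕ x₀)) (arrs s numerators) → k < count (arrs s numerators) n →
      regs s status ≡ 0 → Verdict Φ (arrs s numerators) (regs s reply) →
      wp decide (Next columnIndex TrialInv k) s
    decide-rule {k} s k≡ in≡n row≡ out≡ table trial k< ≡0 v =
      (λ ≢0 → branch (verdict-worst v ≢0)) ,
      (λ r≡0 → k≡ , in≡n , row≡ , out≡ , table , trial ,
        closed (λ j → subst (_≤ 4) (sym (verdict-0 v r≡0 j)) z≤n))
      where
      f = arrs s numerators
      r = regs s reply
      a = arrs s variable₁ r
      v₁ = arrs s falsifier₁ r
      b = arrs s variable₂ r
      v₂ = arrs s falsifier₂ r

      ≢-from : ∀ {x y} → (x ∸ y) + (y ∸ x) ≢ 0 → x ≢ y
      ≢-from ≢0 = ≢0 ∘ difference≡0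

      still-running : ∀ {f} → Progress (suc k) f 0 → Progress (suc k) f (regs s status)
      still-running {f} = subst (Progress (suc k) f) (sym ≡0)

      spelled : ∀ {j} → r ≡ suc (toℕ j) → 0 < weight f (Φ j) → Spelled j a v₁ b v₂
      spelled {j} r≡ >0 =
        let ℓ , ℓ′ , eq , ¬u , ¬u′ = violated-pair (σ , sat) {f} {j} (units trial) >0
        in  spell eq (subst (λ r → Within (arrs s variable₁ r) (arrs s falsifier₁ r)
                                     (arrs s variable₂ r) (arrs s falsifier₂ r) (Φ j))
                        (sym r≡) (proj₂ table j ℓ ℓ′ eq ¬u ¬u′))

      branch : (∃ λ j → r ≡ suc (toℕ j) × 0 < weight f (Φ j) ×
                  (∀ k → weight f (Φ k) ≤ weight f (Φ j))) →
        wp resolve (Next columnIndex TrialInv k) s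
      branch (j , r≡ , >0 , max) =
        (λ ≢₁ → let half₁ = proj₁ open-halves (≢-from ≢₁) in
          (λ ≢₂ → k≡ , in≡n , row≡ , out≡ , table , trial ,
             closed (halves-close sp half₁ (proj₂ open-halves (≢-from ≢₂)) max)) ,
          (λ ≡₂ → k≡ , in≡n , row≡ , out≡ , table ,
             set-literal trial (Spelled.first-code sp) half₁
               (first-implied trial sp (difference≡0⇒ _ _ ≡₂)) ,
             still-running (set-progress (Spelled.first-code sp) half₁ k<))) ,
        (λ ≡₁ →
          (λ ≢₂ → let half₂ = proj₂ open-halves (≢-from ≢₂) in
             k≡ , in≡n , row≡ , out≡ , table ,
             set-literal trial (Spelled.second-code sp) half₂
               (second-implied trial sp (difference≡0⇒ _ _ ≡₁)) ,
             still-running (set-progress (Spelled.second-code sp) half₂ k<)) ,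
          (λ ≡₂ → k≡ , in≡n , row≡ , out≡ , table , trial ,
             contradictory (conflict trial sp (difference≡0⇒ _ _ ≡₁) (difference≡0⇒ _ _ ≡₂))))
        where
        sp = spelled r≡ >0
        open-halves = halves trial sp >0

    progress-running : ∀ {k f st} → Progress k f st → st ≡ 0 → k < count f n
    progress-running (running k<) _ = k<

    progress-halted : ∀ {k f st} → Progress k f st → st ≢ 0 → Progress (suc k) f st
    progress-halted (running _)       ≢0 = contradiction refl ≢0
    progress-halted (closed c)        _  = closed c
    progress-halted (contradictory c) _  = contradictory c

    progress-contradictory : ∀ {k f st} → Progress k f st → st ∸ 1 ≢ 0 → σ x₀ ≡ true
    progress-contradictory (running _)       ≢0 = contradiction refl ≢0
    progress-contradictory (closed _)        ≢0 = contradiction refl ≢0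
    progress-contradictory (contradictory c) _  = c

    -- Still running after `n` rounds would require more than `n` assigned variables.
    progress-closed : ∀ {f st} → Progress n f st → st ∸ 1 ≡ 0 → Closed f
    progress-closed {f} (running n<) _ = contradiction (<-≤-trans n< (count≤ f n)) (<-irrefl refl)
    progress-closed (closed c)       _ = c

    propagate-step : ∀ k s → k < n → regs s columnIndex ≡ k → regs s inputReg ≡ n →
      TrialInv k s → wp propagate (Next columnIndex TrialInv k) s
    propagate-step k s _ k≡ in≡n (row≡ , out≡ , table , trial , progress) =
      (λ ≢0 → k≡ , in≡n , row≡ , out≡ , table , trial , progress-halted progress ≢0) ,
      (λ ≡0 → decide-rule (ask O reply s) k≡ in≡n row≡ out≡ table trial
                (progress-running progress ≡0) ≡0 (verdict is2 O s (proj₁ table)))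

  -- The witness `σ` is existential because accepting a closed assignment replaces it by a
  -- completion of that assignment.
  ExtensionInv : ℕ → State n → Set
  ExtensionInv i s = Table (arrs s) × UnitsHold (arrs s outputs) ×
    (∀ x → x < i → arrs s outputs x ≢ 2) ×
    (∃ λ σ → Satisfies σ Φ × Extends σ (arrs s outputs))

  attempt-rule : ∀ s (x₀ : Fin n) → regs s inputReg ≡ n → regs s rowIndex ≡ toℕ x₀ →
    ExtensionInv (toℕ x₀) s → arrs s outputs (toℕ x₀) ≡ 2 →
    wp attempt (Next rowIndex ExtensionInv (toℕ x₀)) s
  attempt-rule s x₀ in≡n row≡ (table , unitsHold , below , σ , sat , extends) ≡2 =
    load-rule s in≡n table λ s₁ in≡n₁ row≡₁ table₁ out≡₁ copied →
    let row≡′ = trans row≡₁ row≡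
        -- Making `x₀` false is an instance of setting its negative literal, whose falsifier is 4,
        -- and `4 ∸ 4 = 0`. That this literal holds under `σ` is the very condition in `extended`,
        -- hence `id`.
        trial = set-literal {ℓ = literal x₀ false}
                  (Trial-cong (<⇒≤ (toℕ<n x₀)) (λ x x<n → sym (copied x x<n)) saved)
                  (refl , refl) (trans (copied i (toℕ<n x₀)) ≡2) id
        i≢2 = subst (_≢ 2) (sym (update-same (arrs s₁ numerators) i)) (level≢2 false)
    in subst
      (λ a → wp (status ≔ const 0 ⨟ for columnIndex propagate ⨟ settle)
        (Next rowIndex ExtensionInv i) (setArr numerators a 0 s₁))
      (sym row≡′)
      (for-rule columnIndex refl propagate (TrialInv σ sat x₀ (arrs s outputs))
        (propagate-step σ sat x₀ (arrs s outputs)) in≡n₁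
        (row≡′ , out≡₁ , table₁ ,
         record { Trial trial ; set-below = all-below-suc (set-below trial) i≢2 } ,
         -- The tried variable itself is assigned, which accounts for round 0.
         running (0<count _ n (toℕ<n x₀) i≢2))
        settle-rule)
    where
    open Attempt σ sat x₀
    open Trial

    i = toℕ x₀

    saved : Trial i (arrs s outputs)
    saved = record
      { partial   = λ x → Sum.map₂ (σ x ,_) (extends x)
      ; units     = unitsHold
      ; extended  = λ _ → extends
      ; set-below = below }

    settle-rule : ∀ s′ → regs s′ inputReg ≡ n → TrialInv σ sat x₀ (arrs s outputs) n s′ →
      wp settle (Next rowIndex ExtensionInv i) s′
    settle-rule s′ in≡n (row≡ , out≡ , table , trial , progress) = reject , accept
      where
      B = arrs s outputs
      f = arrs s′ numerators

      reject : regs s′ status ∸ 1 ≢ 0 →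
        wp (outputs [ reg rowIndex ]≔ const 4) (Next rowIndex ExtensionInv i) s′
      reject ≢0 = subst₂
        (λ a B → regs s′ rowIndex ≡ i × regs s′ inputReg ≡ n × Table (arrs s′) ×
           UnitsHold (update a 4 B) × (∀ x → x < suc i → update a 4 B x ≢ 2) ×
           (∃ λ σ → Satisfies σ Φ × Extends σ (update a 4 B)))
        (sym row≡) (sym out≡)
        (row≡ , in≡n , table ,
         (λ ℓ u → case update-cases B i {4} (toℕ (var ℓ)) of λ
           { (inj₁ (i≡ , _)) → contradiction
               (trans (sym (unitsHold ℓ u)) (trans (cong B (sym i≡)) ≡2)) (level≢2 (positive ℓ))
           ; (inj₂ (_ , eq)) → trans eq (unitsHold ℓ u) }) ,
         all-below-suc (λ x x<i → update-preserves (_≢ 2) B i x (λ ()) (below x x<i))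
           (subst (_≢ 2) (sym (update-same B i)) λ ()) ,
         σ , sat ,
         (λ x → case update-cases B i {4} (toℕ x) of λ
           -- The contradiction shows that `σ x₀` is true, so `σ` still extends the corrected
           -- outputs.
           { (inj₁ (i≡ , eq)) → inj₂ (trans eq (cong level (trans
               (sym (progress-contradictory σ sat x₀ B progress ≢0)) (cong σ (toℕ-injective i≡)))))
           ; (inj₂ (_ , eq))  → Sum.map (trans eq) (trans eq) (extends x) }))

      accept : regs s′ status ∸ 1 ≡ 0 → wp save (Next rowIndex ExtensionInv i) s′
      accept ≡0 = save-rule s′ in≡n λ s″ in≡n″ row≡″ table″ copied →
        let trial″ = Trial-cong (toℕ<n x₀) copied trial
            closed = progress-closed σ sat x₀ B progress ≡0
        in  trans row≡″ row≡ , in≡n″ , table″ table , units trial″ , set-below trial″ ,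
            -- A closed assignment is kept even where it disagrees with `σ`, since its completion by
            -- `σ` is again satisfying.
            complete f σ , complete-satisfies (partial trial) (units trial) closed sat ,
            λ x → subst (λ y → y ≡ 2 ⊎ y ≡ level (complete f σ x))
                    (copied (toℕ x) (toℕ<n x)) (complete-extends {f} {σ} (partial trial) x)

  <⇒Fin : ∀ {k} → k < n → ∃ λ (x : Fin n) → k ≡ toℕ x
  <⇒Fin k<n = fromℕ< k<n , sym (toℕ-fromℕ< k<n)

  extend-rule : ∀ {Q} s → regs s inputReg ≡ n → ExtensionInv 0 s →
    (∀ s′ → ExtensionInv n s′ → Q s′) → wp extend Q s
  extend-rule s in≡n inv exit = for-rule rowIndex refl extendStep ExtensionInv step in≡n inv
    (λ s′ _ → exit s′)
    where
    step : ∀ i s → i < n → regs s rowIndex ≡ i → regs s inputReg ≡ n → ExtensionInv i s →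
           wp extendStep (Next rowIndex ExtensionInv i) s
    step i s i<n row≡ in≡n inv@(table , units , below , extendable) with <⇒Fin i<n
    ... | x₀ , refl =
      (λ ≢0 → row≡ , in≡n , table , units ,
        all-below-suc below (λ ≡2 → ≢0 (difference≡0
          (trans (cong (arrs s outputs) row≡) ≡2))) ,
        extendable) ,
      (λ ≡0 → attempt-rule s x₀ in≡n row≡ inv
        (trans (cong (arrs s outputs) (sym row≡)) (difference≡0⇒ _ _ ≡0)))

  extension-satisfies : ∀ s → ExtensionInv n s → Satisfies (output s) Φ
  extension-satisfies s (_ , _ , below , σ , sat , extends) j =
    Any.map (λ {ℓ} → trans (agree (var ℓ))) (sat j)
    where
    agree : ∀ x → output s x ≡ σ x
    agree x with extends x
    ... | inj₁ ≡2 = contradiction ≡2 (below (toℕ x) (toℕ<n x))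
    ... | inj₂ ≡σ = trans (cong (λ y → not (y ≡ᵇ 0)) ≡σ) (not-≡ᵇ-level (σ x))

  solved-satisfies : ∀ (f : ℕ → ℕ) s → (∀ x → x < n → f x ≡ arrs s outputs x) →
    (∀ j → weight f (Φ j) ≡ 0) → Satisfies (output s) Φ
  solved-satisfies f s copied all0 j =
    Any.map (λ {ℓ} ≡0 → trans
      (cong (λ y → not (y ≡ᵇ 0)) (sym (copied (toℕ (var ℓ)) (toℕ<n (var ℓ)))))
      (falsity≡0⇒ (positive ℓ) (f (toℕ (var ℓ))) ≡0))
    (weight≡0⇒ f {literals (Φ j)} (all0 j))

  correct : RepetitionFree Φ → Satisfiable Φ →
            wp algorithm₂SAT (λ s → Satisfies (output s) Φ) (initial n)
  correct rf (σ , sat) = identify-rule (initial n) refl refl λ s in≡n outcome →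
    outcome-cases {s = s} outcome
      (λ _ solved → save-rule s in≡n λ s′ _ _ _ copied →
        solved-satisfies (arrs s numerators) s′ copied solved)
      (λ _ identified → let open Knowledge (knowledge rf {mem s} identified) in
        extend-rule s in≡n
          ((denoms≡3 sound-memory , λ j ℓ ℓ′ → pairs) , units , (λ _ ()) ,
           σ , sat , consistent sound-memory)
          extension-satisfies)
    where
    open Identify is2 σ sat O
    open Sound

theorem4 : ∃ λ (algorithm : Cmd) → ∃ λ (T : ℕ → ℕ) →
    T ∈O (λ n → n ^ 2) ×
    (∀ {n m} (Φ : Formula n m) →
    Is2SAT Φ → RepetitionFree Φ → Satisfiable Φ → (O : Oracle Φ) →
    ∃₂ λ s t →
    O ⊢ algorithm , initial n ⇓ s [ t ] ×
    t ≤ T n ×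
    Satisfies (output s) Φ)
-- `nesting algorithm₂SAT` computes to 2, which makes `cost-O` the quadratic bound.
theorem4 = toCmd algorithm₂SAT , (λ n → cost n algorithm₂SAT) , cost-O algorithm₂SAT ,
  λ Φ is2 rf satisfiable O → Hoare.wp-sound O algorithm₂SAT (Run.correct is2 O rf satisfiable)
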